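{- Fix $0<\alpha<1$ and $0<p_1<\frac12<p_2<1$, and suppose $(1-\alpha)(1-p_1)+\alpha(1-p_2)>\frac12$. For each $d\ge1$ let $\mu_d$ be the distribution on $Q_d$ given by \[ \mu_d(X)=(1-\alpha)p_1^{|X|}(1-p_1)^{d-|X|}+\alpha\,p_2^{|X|}(1-p_2)^{d-|X|}. \] (Then $w_i^0=(1-\alpha)(1-p_1)+\alpha(1-p_2)>\frac12$ for every $i$, so the majority point is $\mathbf 0$.) For every $d\ge1$, under $\mu_d$ at least one of the following holds: (a) $\mathbf 0$ is a best response to $\mathbf 0$, and hence $(\mathbf 0,\mathbf 0)$ is an equilibrium; (b) $\mathbf 1$ is a best response to $\mathbf 0$. Moreover, $P_1(\mathbf 1,\mathbf 0)\to\alpha$ as $d\to\infty$; in particular, if $\alpha>\frac12$ then for all sufficiently large $d$, $P_1(\mathbf 1,\mathbf 0)>\frac12$, so $(\mathbf 0,\mathbf 0)$ is not an equilibrium and $\mathbf 1$ is a best response to $\mathbf 0$, while if $\alpha<\frac12$ then for all sufficiently large $d$, $(\mathbf 0,\mathbf 0)$ is an equilibrium.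
   Context: $Q_d=\{0,1\}^d$ with the Hamming distance $d(X,Y)=|\{i: x_i\neq y_i\}|$; $|X|$ is the number of coordinates equal to $1$. For a probability distribution $\mu$ on $Q_d$ (extended additively to subsets), and $A,B\in Q_d$, let $V(A,B)=\{Z: d(Z,A)<d(Z,B)\}$, $T(A,B)=\{Z: d(Z,A)=d(Z,B)\}$, $P_1(A,B)=\mu(V(A,B))+\frac12\mu(T(A,B))$, $P_2(A,B)=\mu(V(B,A))+\frac12\mu(T(A,B))$. $(A,B)$ is an equilibrium if $P_1(A,B)\ge P_1(A',B)$ for all $A'$ and $P_2(A,B)\ge P_2(A,B')$ for all $B'$. $X$ is a best response to $B$ if $P_1(X,B)\ge P_1(X',B)$ for all $X'\in Q_d$. $w_i^0=\mu(\{Z: z_i=0\})$. $\mathbf 0=(0,\dots,0)$, $\mathbf 1=(1,\dots,1)$. -}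

module Defs where

open import Data.Bool.Base using (Bool; true; false)
open import Data.Bool.Properties using () renaming (_≟_ to _≟ᵇ_)
open import Data.Fin.Base using (Fin)
open import Data.List.Base as List using (List; []; _∷_; _++_; filter; foldr)
open import Data.Nat.Base as ℕ using (ℕ; zero; suc)
import Data.Nat.Properties as ℕ
open import Data.Product.Base using (∃-syntax; _×_; _,_)
open import Data.Rational.Base as ℚ using (ℚ; 0ℚ; 1ℚ)
import Data.Rational.Properties as ℚ
open import Data.Rational.Solver using (module +-*-Solver)
open import Data.Sum.Base using (inj₁; inj₂)
open import Data.Vec.Base as Vec using (Vec; lookup; replicate; zip; count)
open import Level using (0ℓ)
open import Relation.Binary.PropositionalEquality using (_≡_; refl; sym; trans; cong; subst; subst₂)
open import Relation.Nullary.Decidable using (¬?)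
open import Relation.Unary using (Pred; Decidable)

------------------------------------------------------------------------
-- Real numbers, as Cauchy sequences of rationals.  The quotient is not
-- formed: equality of reals is the relation _≈_.

IsCauchy : (ℕ → ℚ) → Set
IsCauchy s = ∀ ε → 0ℚ ℚ.< ε →
  ∃[ N ] (∀ m n → N ℕ.≤ m → N ℕ.≤ n → ℚ.∣ s m ℚ.- s n ∣ ℚ.< ε)

record ℝ : Set where
  constructor mkℝ
  field
    seq    : ℕ → ℚ
    cauchy : IsCauchy seq

open ℝ public

private

  half-pos : ∀ {ε} → 0ℚ ℚ.< ε → 0ℚ ℚ.< ℚ.½ ℚ.* ε
  half-pos {ε} 0<ε = subst (ℚ._< ℚ.½ ℚ.* ε) (ℚ.*-zeroʳ ℚ.½) (ℚ.*-monoʳ-<-pos ℚ.½ 0<ε)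

  halves : ∀ ε → ℚ.½ ℚ.* ε ℚ.+ ℚ.½ ℚ.* ε ≡ ε
  halves ε = trans (sym (ℚ.*-distribʳ-+ ε ℚ.½ ℚ.½)) (ℚ.*-identityˡ ε)

  ∣∣-lub : ∀ {x e} → x ℚ.≤ e → ℚ.- x ℚ.≤ e → ℚ.∣ x ∣ ℚ.≤ e
  ∣∣-lub {x} x≤e -x≤e with ℚ.∣p∣≡p∨∣p∣≡-p x
  ... | inj₁ eq = subst (ℚ._≤ _) (sym eq) x≤e
  ... | inj₂ eq = subst (ℚ._≤ _) (sym eq) -x≤e

  ∣p∣≤∣p-q∣+∣q∣ : ∀ p q → ℚ.∣ p ∣ ℚ.≤ ℚ.∣ p ℚ.- q ∣ ℚ.+ ℚ.∣ q ∣
  ∣p∣≤∣p-q∣+∣q∣ p q = subst (λ z → ℚ.∣ z ∣ ℚ.≤ ℚ.∣ p ℚ.- q ∣ ℚ.+ ℚ.∣ q ∣)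
    (solve 2 (λ a b → (a :- b) :+ b := a) refl p q)
    (ℚ.∣p+q∣≤∣p∣+∣q∣ (p ℚ.- q) q)
    where open +-*-Solver

  ∣p-q∣≡∣q-p∣ : ∀ p q → ℚ.∣ p ℚ.- q ∣ ≡ ℚ.∣ q ℚ.- p ∣
  ∣p-q∣≡∣q-p∣ p q = trans (cong ℚ.∣_∣ (solve 2 (λ a b → a :- b := :- (b :- a)) refl p q))
    (ℚ.∣-p∣≡∣p∣ (q ℚ.- p))
    where open +-*-Solver

  ∣p∣-∣q∣≤∣p-q∣ : ∀ p q → ℚ.∣ p ∣ ℚ.- ℚ.∣ q ∣ ℚ.≤ ℚ.∣ p ℚ.- q ∣
  ∣p∣-∣q∣≤∣p-q∣ p q = subst (ℚ.∣ p ∣ ℚ.- ℚ.∣ q ∣ ℚ.≤_)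
    (solve 2 (λ a b → (a :+ b) :- b := a) refl ℚ.∣ p ℚ.- q ∣ ℚ.∣ q ∣)
    (ℚ.+-monoˡ-≤ (ℚ.- ℚ.∣ q ∣) (∣p∣≤∣p-q∣+∣q∣ p q))
    where open +-*-Solver

  ∣∣p∣-∣q∣∣≤∣p-q∣ : ∀ p q → ℚ.∣ ℚ.∣ p ∣ ℚ.- ℚ.∣ q ∣ ∣ ℚ.≤ ℚ.∣ p ℚ.- q ∣
  ∣∣p∣-∣q∣∣≤∣p-q∣ p q = ∣∣-lub (∣p∣-∣q∣≤∣p-q∣ p q)
    (subst₂ ℚ._≤_ (solve 2 (λ a b → a :- b := :- (b :- a)) refl ℚ.∣ q ∣ ℚ.∣ p ∣)
                  (∣p-q∣≡∣q-p∣ q p) (∣p∣-∣q∣≤∣p-q∣ q p))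
    where open +-*-Solver

  0<1 : 0ℚ ℚ.< 1ℚ
  0<1 = ℚ.positive⁻¹ 1ℚ

  Bounded : (ℕ → ℚ) → Set
  Bounded u = ∃[ B ] ∃[ N ] (0ℚ ℚ.< B × (∀ n → N ℕ.≤ n → ℚ.∣ u n ∣ ℚ.≤ B))

  bounded : ∀ s → IsCauchy s → Bounded s
  bounded s cs with cs 1ℚ 0<1
  ... | N , hN = 1ℚ ℚ.+ ℚ.∣ s N ∣ , N
    , subst (ℚ._< 1ℚ ℚ.+ ℚ.∣ s N ∣) (ℚ.+-identityʳ 0ℚ) (ℚ.+-mono-<-≤ 0<1 (ℚ.0≤∣p∣ (s N)))
    , λ n n≥ → ℚ.≤-trans (∣p∣≤∣p-q∣+∣q∣ (s n) (s N))
        (ℚ.+-monoˡ-≤ ℚ.∣ s N ∣ (ℚ.<⇒≤ (hN n N n≥ ℕ.≤-refl)))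

  -- Splits ε as B * δ + C * δ with δ > 0.
  split : ∀ B C ε → 0ℚ ℚ.< B → 0ℚ ℚ.< C → 0ℚ ℚ.< ε →
    ∃[ δ ] (0ℚ ℚ.< δ × B ℚ.* δ ℚ.+ C ℚ.* δ ≡ ε)
  split B C ε 0<B 0<C 0<ε = ℚ.1/ D ℚ.* ε , 0<δ , eq
    where
    D = B ℚ.+ C
    instance
      D-pos : ℚ.Positive D
      D-pos = ℚ.positive (subst (ℚ._< D) (ℚ.+-identityʳ 0ℚ) (ℚ.+-mono-< 0<B 0<C))
      D-nz : ℚ.NonZero D
      D-nz = ℚ.pos⇒nonZero D
      1/D-pos : ℚ.Positive (ℚ.1/ D)
      1/D-pos = ℚ.1/pos⇒pos D
    0<δ : 0ℚ ℚ.< ℚ.1/ D ℚ.* ε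
    0<δ = subst (ℚ._< ℚ.1/ D ℚ.* ε) (ℚ.*-zeroʳ (ℚ.1/ D)) (ℚ.*-monoʳ-<-pos (ℚ.1/ D) 0<ε)
    eq : B ℚ.* (ℚ.1/ D ℚ.* ε) ℚ.+ C ℚ.* (ℚ.1/ D ℚ.* ε) ≡ ε
    eq = trans (sym (ℚ.*-distribʳ-+ (ℚ.1/ D ℚ.* ε) B C))
      (trans (sym (ℚ.*-assoc D (ℚ.1/ D) ε))
        (trans (cong (ℚ._* ε) (ℚ.*-inverseʳ D)) (ℚ.*-identityˡ ε)))

  *-bound : ∀ x y B δ → 0ℚ ℚ.< B → ℚ.∣ x ∣ ℚ.≤ B → ℚ.∣ y ∣ ℚ.< δ → ℚ.∣ x ℚ.* y ∣ ℚ.< B ℚ.* δ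
  *-bound x y B δ 0<B x≤B y<δ = subst (ℚ._< B ℚ.* δ) (sym (ℚ.∣p*q∣≡∣p∣*∣q∣ x y))
    (ℚ.≤-<-trans (ℚ.*-monoʳ-≤-nonNeg ℚ.∣ y ∣ {{ℚ.∣-∣-nonNeg y}} {ℚ.∣ x ∣} {B} x≤B)
                 (ℚ.*-monoʳ-<-pos B {{ℚ.positive 0<B}} {ℚ.∣ y ∣} {δ} y<δ))

  *-diff : ∀ a b c d → a ℚ.* (c ℚ.- d) ℚ.+ d ℚ.* (a ℚ.- b) ≡ a ℚ.* c ℚ.- b ℚ.* d
  *-diff = solve 4 (λ a b c d → a :* (c :- d) :+ d :* (a :- b) := a :* c :- b :* d) refl
    where open +-*-Solver

  *-close : ∀ a b c d B C δ → 0ℚ ℚ.< B → 0ℚ ℚ.< C → ℚ.∣ a ∣ ℚ.≤ B → ℚ.∣ d ∣ ℚ.≤ C →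
    ℚ.∣ a ℚ.- b ∣ ℚ.< δ → ℚ.∣ c ℚ.- d ∣ ℚ.< δ →
    ℚ.∣ a ℚ.* c ℚ.- b ℚ.* d ∣ ℚ.< B ℚ.* δ ℚ.+ C ℚ.* δ
  *-close a b c d B C δ 0<B 0<C a≤B d≤C a-b<δ c-d<δ =
    subst (λ z → ℚ.∣ z ∣ ℚ.< B ℚ.* δ ℚ.+ C ℚ.* δ) (*-diff a b c d)
      (ℚ.≤-<-trans (ℚ.∣p+q∣≤∣p∣+∣q∣ (a ℚ.* (c ℚ.- d)) (d ℚ.* (a ℚ.- b)))
        (ℚ.+-mono-<
          {ℚ.∣ a ℚ.* (c ℚ.- d) ∣} {B ℚ.* δ} {ℚ.∣ d ℚ.* (a ℚ.- b) ∣} {C ℚ.* δ}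
          (*-bound a (c ℚ.- d) B δ 0<B a≤B c-d<δ)
          (*-bound d (a ℚ.- b) C δ 0<C d≤C a-b<δ)))

  Modulus : (ℕ → ℚ) → ℚ → Set
  Modulus u δ = ∃[ N ] (∀ m n → N ℕ.≤ m → N ℕ.≤ n → ℚ.∣ u m ℚ.- u n ∣ ℚ.< δ)

-- Abstract so that conversion checking never unfolds these proofs.
private abstract

  const-cauchy : ∀ q → IsCauchy (λ _ → q)
  const-cauchy q ε 0<ε = 0 , λ _ _ _ _ →
    subst (λ z → ℚ.∣ z ∣ ℚ.< ε) (sym (ℚ.+-inverseʳ q)) 0<ε

  +-cauchy : ∀ s t → IsCauchy s → IsCauchy t → IsCauchy (λ n → s n ℚ.+ t n)
  +-cauchy s t cs ct ε 0<ε
    with cs (ℚ.½ ℚ.* ε) (half-pos 0<ε) | ct (ℚ.½ ℚ.* ε) (half-pos 0<ε)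
  ... | M , hM | N , hN = M ℕ.⊔ N , λ m n m≥ n≥ →
    subst₂ (λ z e → ℚ.∣ z ∣ ℚ.< e)
      (solve 4 (λ a b c d → (a :- b) :+ (c :- d) := (a :+ c) :- (b :+ d)) refl (s m) (s n) (t m) (t n))
      (halves ε)
      (ℚ.≤-<-trans (ℚ.∣p+q∣≤∣p∣+∣q∣ (s m ℚ.- s n) (t m ℚ.- t n))
        (ℚ.+-mono-< (hM m n (ℕ.m⊔n≤o⇒m≤o M N m≥) (ℕ.m⊔n≤o⇒m≤o M N n≥))
                    (hN m n (ℕ.m⊔n≤o⇒n≤o M N m≥) (ℕ.m⊔n≤o⇒n≤o M N n≥))))
    where open +-*-Solver

  neg-cauchy : ∀ s → IsCauchy s → IsCauchy (λ n → ℚ.- s n)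
  neg-cauchy s cs ε 0<ε with cs ε 0<ε
  ... | N , hN = N , λ m n m≥ n≥ → subst (λ z → ℚ.∣ z ∣ ℚ.< ε)
    (solve 2 (λ a b → b :- a := (:- a) :- (:- b)) refl (s m) (s n))
    (hN n m n≥ m≥)
    where open +-*-Solver

  abs-cauchy : ∀ s → IsCauchy s → IsCauchy (λ n → ℚ.∣ s n ∣)
  abs-cauchy s cs ε 0<ε with cs ε 0<ε
  ... | N , hN = N , λ m n m≥ n≥ →
    ℚ.≤-<-trans (∣∣p∣-∣q∣∣≤∣p-q∣ (s m) (s n)) (hN m n m≥ n≥)

  *-cauchy : ∀ s t → IsCauchy s → IsCauchy t → IsCauchy (λ n → s n ℚ.* t n)
  *-cauchy s t cs ct ε 0<ε = from-bounds (bounded s cs) (bounded t ct)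
    where
    from-bounds : Bounded s → Bounded t → Modulus (λ n → s n ℚ.* t n) ε
    from-bounds (B , K , 0<B , hB) (C , L , 0<C , hC) = from-split (split B C ε 0<B 0<C 0<ε)
      where
      from-split : ∃[ δ ] (0ℚ ℚ.< δ × B ℚ.* δ ℚ.+ C ℚ.* δ ≡ ε) → Modulus (λ n → s n ℚ.* t n) ε
      from-split (δ , 0<δ , eq) = from-moduli (cs δ 0<δ) (ct δ 0<δ)
        where
        from-moduli : Modulus s δ → Modulus t δ → Modulus (λ n → s n ℚ.* t n) ε
        from-moduli (M , hM) (N , hN) = KL ℕ.⊔ MN , λ m n m≥ n≥ →
          let m≥KL = ℕ.m⊔n≤o⇒m≤o KL MN m≥
              n≥KL = ℕ.m⊔n≤o⇒m≤o KL MN n≥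
              m≥MN = ℕ.m⊔n≤o⇒n≤o KL MN m≥
              n≥MN = ℕ.m⊔n≤o⇒n≤o KL MN n≥
          in subst (ℚ.∣ s m ℚ.* t m ℚ.- s n ℚ.* t n ∣ ℚ.<_) eq
            (*-close (s m) (s n) (t m) (t n) B C δ 0<B 0<C
              (hB m (ℕ.m⊔n≤o⇒m≤o K L m≥KL)) (hC n (ℕ.m⊔n≤o⇒n≤o K L n≥KL))
              (hM m n (ℕ.m⊔n≤o⇒m≤o M N m≥MN) (ℕ.m⊔n≤o⇒m≤o M N n≥MN))
              (hN m n (ℕ.m⊔n≤o⇒n≤o M N m≥MN) (ℕ.m⊔n≤o⇒n≤o M N n≥MN)))
          where
          KL MN : ℕ
          KL = K ℕ.⊔ L
          MN = M ℕ.⊔ N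

infixl 6 _+_ _-_
infixl 7 _*_
infixr 8 _^_
infix  8 -_
infix  4 _≈_ _<_ _≤_

fromℚ : ℚ → ℝ
fromℚ q = mkℝ (λ _ → q) (const-cauchy q)

0ℝ 1ℝ ½ : ℝ
0ℝ = fromℚ 0ℚ
1ℝ = fromℚ 1ℚ
½  = fromℚ ℚ.½

_+_ : ℝ → ℝ → ℝ
x + y = mkℝ (λ n → seq x n ℚ.+ seq y n) (+-cauchy (seq x) (seq y) (cauchy x) (cauchy y))

_*_ : ℝ → ℝ → ℝ
x * y = mkℝ (λ n → seq x n ℚ.* seq y n) (*-cauchy (seq x) (seq y) (cauchy x) (cauchy y))

-_ : ℝ → ℝ
- x = mkℝ (λ n → ℚ.- seq x n) (neg-cauchy (seq x) (cauchy x))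

_-_ : ℝ → ℝ → ℝ
x - y = x + (- y)

∣_∣ : ℝ → ℝ
∣ x ∣ = mkℝ (λ n → ℚ.∣ seq x n ∣) (abs-cauchy (seq x) (cauchy x))

_^_ : ℝ → ℕ → ℝ
x ^ zero  = 1ℝ
x ^ suc n = x * x ^ n

-- The three relations are records so that x and y can be inferred from
-- a proof.

record _≈_ (x y : ℝ) : Set where
  constructor mk≈
  field
    close : ∀ ε → 0ℚ ℚ.< ε →
      ∃[ N ] (∀ n → N ℕ.≤ n → ℚ.∣ seq x n ℚ.- seq y n ∣ ℚ.< ε)

record _<_ (x y : ℝ) : Set where
  constructor mk<
  field
    gap     : ℚ
    gap-pos : 0ℚ ℚ.< gap
    start   : ℕ
    below   : ∀ n → start ℕ.≤ n → seq x n ℚ.+ gap ℚ.≤ seq y n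

record _≤_ (x y : ℝ) : Set where
  constructor mk≤
  field
    below-within : ∀ ε → 0ℚ ℚ.< ε →
      ∃[ N ] (∀ n → N ℕ.≤ n → seq x n ℚ.≤ seq y n ℚ.+ ε)

∑ : List ℝ → ℝ
∑ = foldr _+_ 0ℝ

Eventually : (ℕ → Set) → Set
Eventually P = ∃[ N ] (∀ d → N ℕ.≤ d → P d)

TendsTo : (ℕ → ℝ) → ℝ → Set
TendsTo f ℓ = ∀ ε → 0ℝ < ε → Eventually (λ d → ∣ f d - ℓ ∣ < ε)

------------------------------------------------------------------------
-- The hypercube; coordinate 1 is true and coordinate 0 is false.

Q : ℕ → Set
Q d = Vec Bool d

𝟎 𝟏 : ∀ {d} → Q d
𝟎 = replicate _ false
𝟏 = replicate _ true

weight : ∀ {d} → Q d → ℕ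
weight X = count (_≟ᵇ true) X

dist : ∀ {d} → Q d → Q d → ℕ
dist X Y = count (λ (x , y) → ¬? (x ≟ᵇ y)) (zip X Y)

-- Every point of the hypercube, listed exactly once.
points : ∀ d → List (Q d)
points zero    = Vec.[] ∷ []
points (suc d) = List.map (false Vec.∷_) (points d) ++ List.map (true Vec.∷_) (points d)

------------------------------------------------------------------------
-- Distributions, given by their point masses, and the two-player game.

IsDistribution : ∀ {d} → (Q d → ℝ) → Set
IsDistribution {d} μ = (∀ X → 0ℝ ≤ μ X) × ∑ (List.map μ (points d)) ≈ 1ℝ

measure : ∀ {d} → (Q d → ℝ) → {S : Pred (Q d) 0ℓ} → Decidable S → ℝ
measure {d} μ S? = ∑ (List.map μ (filter S? (points d)))

V : ∀ {d} → Q d → Q d → Pred (Q d) 0ℓ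
V A B Z = dist Z A ℕ.< dist Z B

V? : ∀ {d} (A B : Q d) → Decidable (V A B)
V? A B Z = dist Z A ℕ.<? dist Z B

T : ∀ {d} → Q d → Q d → Pred (Q d) 0ℓ
T A B Z = dist Z A ≡ dist Z B

T? : ∀ {d} (A B : Q d) → Decidable (T A B)
T? A B Z = dist Z A ℕ.≟ dist Z B

P₁ P₂ : ∀ {d} → (Q d → ℝ) → Q d → Q d → ℝ
P₁ μ A B = measure μ (V? A B) + ½ * measure μ (T? A B)
P₂ μ A B = measure μ (V? B A) + ½ * measure μ (T? A B)

IsEquilibrium : ∀ {d} → (Q d → ℝ) → Q d → Q d → Set
IsEquilibrium μ A B = (∀ A′ → P₁ μ A′ B ≤ P₁ μ A B) × (∀ B′ → P₂ μ A B′ ≤ P₂ μ A B)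

-- IsBestResponse μ X B: X is a best response to B.
IsBestResponse : ∀ {d} → (Q d → ℝ) → Q d → Q d → Set
IsBestResponse μ X B = ∀ X′ → P₁ μ X′ B ≤ P₁ μ X B

w⁰ : ∀ {d} → (Q d → ℝ) → Fin d → ℝ
w⁰ μ i = measure μ (λ Z → lookup Z i ≟ᵇ false)

-- Each coordinate of M is held with strict majority.
IsMajorityPoint : ∀ {d} → (Q d → ℝ) → Q d → Set
IsMajorityPoint μ M = ∀ i → ½ < measure μ (λ Z → lookup Z i ≟ᵇ lookup M i)

mixture : (α p₁ p₂ : ℝ) (d : ℕ) → Q d → ℝ
mixture α p₁ p₂ d X =
    (1ℝ - α) * (p₁ ^ weight X * (1ℝ - p₁) ^ (d ℕ.∸ weight X))
  + α * (p₂ ^ weight X * (1ℝ - p₂) ^ (d ℕ.∸ weight X))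

{-# OPTIONS --safe #-}

-- Every operation on ℝ acts termwise on Cauchy sequences, so the argument is
-- carried out for the rationals α, p₁, p₂ at a fixed index.  A position X of
-- weight k beats 𝟎 with probability g(k) = (1 - α) f_k(p₁) + α f_k(p₂), where
-- f_k(p) is the probability that a p-coin shows a majority of heads in k
-- tosses, ties counting ½.  One more toss changes it by
--   f_{k+1}(p) - f_k(p) = (p - ½) c_k (p (1 - p))^⌊k/2⌋,
-- with c_k ≥ 0 the number of balanced toss sequences of length k.  Hence the
-- sign of g(k+1) - g(k) is, unless c_k = 0, that of a r^⌊k/2⌋ - b s^⌊k/2⌋ for
-- a = α (p₂ - ½), b = (1 - α) (½ - p₁), r = p₂ (1 - p₂), s = p₁ (1 - p₁).  The
-- majority hypothesis says a ≤ b, so once g increases it never decreases again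
-- and its maximum on {0, …, d} is attained at 0 or at d.  The limit is
-- Chebyshev's inequality, uniform in the index.

module Submission where

open import Axiom.ExcludedMiddle using (ExcludedMiddle)
open import Data.Bool.Base using (true; false)
open import Data.Bool.Properties using () renaming (_≟_ to _≟ᵇ_)
open import Data.Empty using (⊥-elim)
open import Data.Fin.Base using (Fin; zero; suc)
import Data.Integer.Base as ℤ
import Data.Integer.Properties as ℤ
open import Data.List.Base as List using (List; []; _∷_; _++_; filter; foldr)
open import Data.List.Properties using (map-++; map-∘)
open import Data.Nat.Base as ℕ using (ℕ; zero; suc; ⌊_/2⌋)
import Data.Nat.Properties as ℕ
open import Data.Product.Base using (∃-syntax; _×_; _,_; proj₁; proj₂)
open import Data.Rational.Base as ℚ using (ℚ; 0ℚ; 1ℚ; mkℚ; toℚᵘ)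
import Data.Rational.Properties as ℚ
open import Data.Rational.Solver using (module +-*-Solver)
import Data.Rational.Unnormalised.Base as ℚᵘ
import Data.Rational.Unnormalised.Properties as ℚᵘ
open import Data.Sum.Base as Sum using (_⊎_; inj₁; inj₂)
open import Data.Vec.Base using ([]; _∷_; lookup)
open import Data.Vec.Properties using (count≤n; lookup-replicate)
import Defs
open import Function.Base using (_∘_)
open import Level using (0ℓ)
open import Relation.Binary.PropositionalEquality using (_≡_; refl; sym; trans; cong; cong₂; subst; subst₂)
open import Relation.Nullary.Decidable.Core using (Dec; does; yes; no)
open import Relation.Nullary.Negation using (¬_)
open import Relation.Unary using (Pred; Decidable)

-- Order arithmetic of the rationals.

module RationalWalk where

  open import Data.Rational.Base using (_+_; _*_; _-_; -_; _≤_; _<_; ½)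
  open +-*-Solver

  infixr 8 _^_

  _^_ : ℚ → ℕ → ℚ
  x ^ zero  = 1ℚ
  x ^ suc k = x * x ^ k

  -- Reduces an inequality to an explicit nonnegative difference and a ring identity, which the
  -- solver settles.
  ≤-by-diff : ∀ {x y} e → 0ℚ ≤ e → x + e ≡ y → x ≤ y
  ≤-by-diff {x} e 0≤e eq = subst₂ _≤_ (ℚ.+-identityʳ x) eq (ℚ.+-monoʳ-≤ x 0≤e)

  0≤diff : ∀ {x y} → x ≤ y → 0ℚ ≤ y - x
  0≤diff {x} {y} x≤y = subst (_≤ y - x) (ℚ.+-inverseʳ x) (ℚ.+-monoˡ-≤ (- x) x≤y)

  *-monoˡ : ∀ {r x y} → 0ℚ ≤ r → x ≤ y → r * x ≤ r * y
  *-monoˡ {r} 0≤r = ℚ.*-monoˡ-≤-nonNeg r {{ℚ.nonNegative 0≤r}}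

  *-monoʳ : ∀ {r x y} → 0ℚ ≤ r → x ≤ y → x * r ≤ y * r
  *-monoʳ {r} 0≤r = ℚ.*-monoʳ-≤-nonNeg r {{ℚ.nonNegative 0≤r}}

  0≤* : ∀ {x y} → 0ℚ ≤ x → 0ℚ ≤ y → 0ℚ ≤ x * y
  0≤* {x} {y} 0≤x 0≤y = subst (_≤ x * y) (ℚ.*-zeroʳ x) (*-monoˡ 0≤x 0≤y)

  0≤+ : ∀ {x y} → 0ℚ ≤ x → 0ℚ ≤ y → 0ℚ ≤ x + y
  0≤+ 0≤x 0≤y = ℚ.+-mono-≤ 0≤x 0≤y

  0<* : ∀ {x y} → 0ℚ < x → 0ℚ < y → 0ℚ < x * y
  0<* {x} {y} 0<x 0<y =
    subst (_< x * y) (ℚ.*-zeroʳ x) (ℚ.*-monoʳ-<-pos x {{ℚ.positive 0<x}} 0<y)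

  0≤square : ∀ x → 0ℚ ≤ x * x
  0≤square x with ℚ.≤-total 0ℚ x
  ... | inj₁ 0≤x = 0≤* 0≤x 0≤x
  ... | inj₂ x≤0 = subst (0ℚ ≤_) (solve 1 (λ x → (:- x) :* (:- x) := x :* x) refl x)
    (0≤* (ℚ.neg-antimono-≤ x≤0) (ℚ.neg-antimono-≤ x≤0))

  0≤1 : 0ℚ ≤ 1ℚ
  0≤1 = ℚ.≤ᵇ⇒≤ _

  0≤½ : 0ℚ ≤ ½
  0≤½ = ℚ.≤ᵇ⇒≤ _

  0≤^ : ∀ {x} → 0ℚ ≤ x → ∀ k → 0ℚ ≤ x ^ k
  0≤^ 0≤x zero    = 0≤1
  0≤^ 0≤x (suc k) = 0≤* 0≤x (0≤^ 0≤x k)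

  fromℕ : ℕ → ℚ
  fromℕ zero    = 0ℚ
  fromℕ (suc n) = 1ℚ + fromℕ n

  0≤fromℕ : ∀ n → 0ℚ ≤ fromℕ n
  0≤fromℕ zero    = ℚ.≤-refl
  0≤fromℕ (suc n) = 0≤+ 0≤1 (0≤fromℕ n)

  fromℕ-mono : ∀ {m n} → m ℕ.≤ n → fromℕ m ≤ fromℕ n
  fromℕ-mono {n = n} ℕ.z≤n = 0≤fromℕ n
  fromℕ-mono (ℕ.s≤s m≤n)   = ℚ.+-monoʳ-≤ 1ℚ (fromℕ-mono m≤n)

  toℚᵘ-fromℕ : ∀ n → toℚᵘ (fromℕ n) ℚᵘ.≃ ℚᵘ.mkℚᵘ (ℤ.+ n) 0
  toℚᵘ-fromℕ zero    = ℚᵘ.≃-refl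
  toℚᵘ-fromℕ (suc n) = ℚᵘ.≃-trans (ℚ.toℚᵘ-homo-+ 1ℚ (fromℕ n))
    (ℚᵘ.≃-trans (ℚᵘ.+-congʳ ℚᵘ.1ℚᵘ (toℚᵘ-fromℕ n))
      (ℚᵘ.*≡* (cong (ℤ._* ℤ.+ 1) (cong (λ z → ℤ.+ 1 ℤ.+ z) (ℤ.*-identityʳ (ℤ.+ n))))))

  -- The absolute value of the numerator is a bound, because the denominator is at least 1.
  archimedean : ∀ x → ∃[ n ] x ≤ fromℕ n
  archimedean x@(mkℚ num d-1 _) = ℤ.∣ num ∣ , ℚ.toℚᵘ-cancel-≤
    (ℚᵘ.≤-respʳ-≃ (ℚᵘ.≃-sym (toℚᵘ-fromℕ ℤ.∣ num ∣)) (ℚᵘ.*≤* (num≤ num)))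
    where
    num≤ : ∀ m → m ℤ.* ℤ.+ 1 ℤ.≤ ℤ.+ ℤ.∣ m ∣ ℤ.* ℤ.+ suc d-1
    num≤ (ℤ.+ m)      = ℤ.*-monoˡ-≤-nonNeg (ℤ.+ m) (ℤ.+≤+ (ℕ.s≤s ℕ.z≤n))
    num≤ (ℤ.-[1+ m ]) = ℤ.-≤+

  -- The walk of the two distances and the increments of its winning probability.

  -- The share of a voter at distances a and b from the two positions. The recursion on both
  -- arguments makes invariance under a common shift hold by computation.
  score : ℕ → ℕ → ℚ
  score zero    zero    = ½
  score zero    (suc b) = 1ℚ
  score (suc a) zero    = 0ℚ
  score (suc a) (suc b) = score a b

  diagonal : ℕ → ℕ → ℚ
  diagonal zero    zero    = 1ℚ
  diagonal zero    (suc b) = 0ℚ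
  diagonal (suc a) zero    = 0ℚ
  diagonal (suc a) (suc b) = diagonal a b

  -- The coordinates a and b stand for dist Z X and dist Z 𝟎: a random bit in
  -- the support of X increases exactly one of them.
  walk : ℚ → ℕ → (ℕ → ℕ → ℚ) → ℕ → ℕ → ℚ
  walk p zero    φ a b = φ a b
  walk p (suc k) φ a b = p * walk p k φ a (suc b) + (1ℚ - p) * walk p k φ (suc a) b

  -- The number of k-step paths from (a , b) to the diagonal. At (0 , 0) it is c_k of the overview:
  -- a central binomial coefficient for even k and 0 for odd k.
  returns : ℕ → ℕ → ℕ → ℚ
  returns zero    a b = diagonal a b
  returns (suc k) a b = returns k a (suc b) + returns k (suc a) b

  win : ℚ → ℕ → ℚ
  win p k = walk p k score 0 0

  0≤score : ∀ a b → 0ℚ ≤ score a b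
  0≤score zero    zero    = 0≤½
  0≤score zero    (suc b) = 0≤1
  0≤score (suc a) zero    = ℚ.≤-refl
  0≤score (suc a) (suc b) = 0≤score a b

  score-complement : ∀ a b → 1ℚ - score b a ≡ score a b
  score-complement zero    zero    = refl
  score-complement zero    (suc b) = refl
  score-complement (suc a) zero    = refl
  score-complement (suc a) (suc b) = score-complement a b

  diagonal-sym : ∀ a b → diagonal a b ≡ diagonal b a
  diagonal-sym zero    zero    = refl
  diagonal-sym zero    (suc b) = refl
  diagonal-sym (suc a) zero    = refl
  diagonal-sym (suc a) (suc b) = diagonal-sym a b

  0≤diagonal : ∀ a b → 0ℚ ≤ diagonal a b
  0≤diagonal zero    zero    = 0≤1
  0≤diagonal zero    (suc b) = ℚ.≤-refl
  0≤diagonal (suc a) zero    = ℚ.≤-refl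
  0≤diagonal (suc a) (suc b) = 0≤diagonal a b

  returns-sym : ∀ k a b → returns k a b ≡ returns k b a
  returns-sym zero    a b = diagonal-sym a b
  returns-sym (suc k) a b = trans (ℚ.+-comm (returns k a (suc b)) (returns k (suc a) b))
    (cong₂ _+_ (returns-sym k (suc a) b) (returns-sym k a (suc b)))

  0≤returns : ∀ k a b → 0ℚ ≤ returns k a b
  0≤returns zero    a b = 0≤diagonal a b
  0≤returns (suc k) a b = 0≤+ (0≤returns k a (suc b)) (0≤returns k (suc a) b)

  0≤walk-score : ∀ {p} → 0ℚ ≤ p → p ≤ 1ℚ → ∀ k a b → 0ℚ ≤ walk p k score a b
  0≤walk-score 0≤p p≤1 zero    a b = 0≤score a b
  0≤walk-score 0≤p p≤1 (suc k) a b = 0≤+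
    (0≤* 0≤p (0≤walk-score 0≤p p≤1 k a (suc b)))
    (0≤* (0≤diff p≤1) (0≤walk-score 0≤p p≤1 k (suc a) b))

  -- Replacing p by 1 - p and exchanging the coordinates mirrors every path in the diagonal, which
  -- turns wins into losses and keeps ties.
  walk-complement : ∀ p k a b → 1ℚ - walk (1ℚ - p) k score b a ≡ walk p k score a b
  walk-complement p zero    a b = score-complement a b
  walk-complement p (suc k) a b = trans
    (solve 3 (λ p u v → con 1ℚ :- ((con 1ℚ :- p) :* u :+ (con 1ℚ :- (con 1ℚ :- p)) :* v)
                      := p :* (con 1ℚ :- v) :+ (con 1ℚ :- p) :* (con 1ℚ :- u))
      refl p (walk (1ℚ - p) k score b (suc a)) (walk (1ℚ - p) k score (suc b) a))
    (cong₂ (λ u v → p * u + (1ℚ - p) * v) (walk-complement p k a (suc b)) (walk-complement p k (suc a) b))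

  -- Off the diagonal both sides vanish. On it a = b, so the exponent on the right is a as well.
  diagonal-weight : ∀ x y a b →
    x ^ b * (y ^ a * diagonal a b) ≡ diagonal a b * (x * y) ^ ⌊ a ℕ.+ b /2⌋
  diagonal-weight x y zero    zero    = refl
  diagonal-weight x y zero    (suc b) = solve 2 (λ u v → u :* (con 1ℚ :* con 0ℚ) := con 0ℚ :* v) refl
    (x ^ suc b) ((x * y) ^ ⌊ suc b /2⌋)
  diagonal-weight x y (suc a) zero    = solve 2 (λ u v → con 1ℚ :* (u :* con 0ℚ) := con 0ℚ :* v) refl
    (y ^ suc a) ((x * y) ^ ⌊ suc a ℕ.+ 0 /2⌋)
  diagonal-weight x y (suc a) (suc b) rewrite ℕ.+-suc a b = trans
    (solve 5 (λ x y u v e → (x :* u) :* ((y :* v) :* e) := (x :* y) :* (u :* (v :* e))) refl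
      x y (x ^ b) (y ^ a) (diagonal a b))
    (trans (cong (x * y *_) (diagonal-weight x y a b))
      (solve 3 (λ z e w → z :* (e :* w) := e :* (z :* w)) refl
        (x * y) (diagonal a b) ((x * y) ^ ⌊ a ℕ.+ b /2⌋)))

  -- A path that ends on the diagonal uses as many factors p as factors
  -- 1 - p, once those for the starting point (a , b) are included.
  walk-diagonal : ∀ p k a b →
    p ^ b * ((1ℚ - p) ^ a * walk p k diagonal a b)
      ≡ returns k a b * (p * (1ℚ - p)) ^ ⌊ k ℕ.+ (a ℕ.+ b) /2⌋
  walk-diagonal p zero    a b = diagonal-weight p (1ℚ - p) a b
  walk-diagonal p (suc k) a b = trans
    (solve 6 (λ p q u v e f → u :* (v :* (p :* e :+ q :* f))
                          := (p :* u) :* (v :* e) :+ u :* ((q :* v) :* f)) refl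
      p (1ℚ - p) (p ^ b) ((1ℚ - p) ^ a) (walk p k diagonal a (suc b)) (walk p k diagonal (suc a) b))
    (trans (cong₂ _+_
        (trans (walk-diagonal p k a (suc b))
          (cong (λ m → returns k a (suc b) * z ^ ⌊ m /2⌋)
            (trans (cong (k ℕ.+_) (ℕ.+-suc a b)) (ℕ.+-suc k (a ℕ.+ b)))))
        (trans (walk-diagonal p k (suc a) b)
          (cong (λ m → returns k (suc a) b * z ^ ⌊ m /2⌋) (ℕ.+-suc k (a ℕ.+ b)))))
      (sym (ℚ.*-distribʳ-+ (z ^ ⌊ suc k ℕ.+ (a ℕ.+ b) /2⌋) (returns k a (suc b)) (returns k (suc a) b))))
    where
    z : ℚ
    z = p * (1ℚ - p)

  -- One step changes the expected score only near the diagonal. From a tie the change is p - ½;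
  -- from a neighbouring point it is half the probability of stepping onto a tie, gained from a loss
  -- or given up from a win.
  score-step : ∀ p a b →
    p * score a (suc b) + (1ℚ - p) * score (suc a) b
      ≡ score a b + ((p - ½) * diagonal a b
          + ½ * (p * diagonal a (suc b) - (1ℚ - p) * diagonal (suc a) b))
  score-step p zero zero = solve 1 (λ p → p :* con 1ℚ :+ (con 1ℚ :- p) :* con 0ℚ
    := con ½ :+ ((p :- con ½) :* con 1ℚ :+ con ½ :* (p :* con 0ℚ :- (con 1ℚ :- p) :* con 0ℚ))) refl p
  score-step p zero (suc zero) = solve 1 (λ p → p :* con 1ℚ :+ (con 1ℚ :- p) :* con ½
    := con 1ℚ :+ ((p :- con ½) :* con 0ℚ :+ con ½ :* (p :* con 0ℚ :- (con 1ℚ :- p) :* con 1ℚ))) refl p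
  score-step p zero (suc (suc b)) = solve 1 (λ p → p :* con 1ℚ :+ (con 1ℚ :- p) :* con 1ℚ
    := con 1ℚ :+ ((p :- con ½) :* con 0ℚ :+ con ½ :* (p :* con 0ℚ :- (con 1ℚ :- p) :* con 0ℚ))) refl p
  score-step p (suc zero) zero = solve 1 (λ p → p :* con ½ :+ (con 1ℚ :- p) :* con 0ℚ
    := con 0ℚ :+ ((p :- con ½) :* con 0ℚ :+ con ½ :* (p :* con 1ℚ :- (con 1ℚ :- p) :* con 0ℚ))) refl p
  score-step p (suc (suc a)) zero = solve 1 (λ p → p :* con 0ℚ :+ (con 1ℚ :- p) :* con 0ℚ
    := con 0ℚ :+ ((p :- con ½) :* con 0ℚ :+ con ½ :* (p :* con 0ℚ :- (con 1ℚ :- p) :* con 0ℚ))) refl p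
  score-step p (suc a) (suc b) = score-step p a b

  -- `walk` is linear in its final payoff, so averaging `score-step` over the position after k steps
  -- gives the same formula with walks in place of values.
  walk-score-step : ∀ p k a b →
    walk p (suc k) score a b
      ≡ walk p k score a b + ((p - ½) * walk p k diagonal a b
          + ½ * (p * walk p k diagonal a (suc b) - (1ℚ - p) * walk p k diagonal (suc a) b))
  walk-score-step p zero    a b = score-step p a b
  walk-score-step p (suc k) a b = trans
    (cong₂ (λ u v → p * u + (1ℚ - p) * v) (walk-score-step p k a (suc b)) (walk-score-step p k (suc a) b))
    (solve 9 (λ p h s t e f u v w →
        p :* (s :+ ((p :- h) :* e :+ h :* (p :* u :- (con 1ℚ :- p) :* v)))
          :+ (con 1ℚ :- p) :* (t :+ ((p :- h) :* f :+ h :* (p :* v :- (con 1ℚ :- p) :* w)))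
        := (p :* s :+ (con 1ℚ :- p) :* t)
          :+ ((p :- h) :* (p :* e :+ (con 1ℚ :- p) :* f)
            :+ h :* (p :* (p :* u :+ (con 1ℚ :- p) :* v) :- (con 1ℚ :- p) :* (p :* v :+ (con 1ℚ :- p) :* w))))
      refl p ½ (walk p k score a (suc b)) (walk p k score (suc a) b)
      (walk p k diagonal a (suc b)) (walk p k diagonal (suc a) b)
      (walk p k diagonal a (suc (suc b))) (walk p k diagonal (suc a) (suc b)) (walk p k diagonal (suc (suc a)) b))

  -- Started at the origin, the contributions from the two sides of the diagonal cancel, and only
  -- the paths tied after k steps remain.
  win-step : ∀ p k →
    win p (suc k) ≡ win p k + (p - ½) * (returns k 0 0 * (p * (1ℚ - p)) ^ ⌊ k /2⌋)
  win-step p k = trans (walk-score-step p k 0 0)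
    (cong (win p k +_) (trans
      (cong₂ (λ u v → (p - ½) * u + ½ * v) at-origin off-diagonal)
      (solve 1 (λ u → u :+ con ½ :* con 0ℚ := u) refl ((p - ½) * (returns k 0 0 * z ^ ⌊ k /2⌋)))))
    where
    z : ℚ
    z = p * (1ℚ - p)
    at-origin : walk p k diagonal 0 0 ≡ returns k 0 0 * z ^ ⌊ k /2⌋
    at-origin = trans (solve 1 (λ u → u := con 1ℚ :* (con 1ℚ :* u)) refl (walk p k diagonal 0 0))
      (trans (walk-diagonal p k 0 0) (cong (λ m → returns k 0 0 * z ^ ⌊ m /2⌋) (ℕ.+-identityʳ k)))
    -- The two one-sided terms have equal weights, and equally many paths by symmetry.
    off-diagonal : p * walk p k diagonal 0 1 - (1ℚ - p) * walk p k diagonal 1 0 ≡ 0ℚ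
    off-diagonal = trans
      (cong₂ _-_
        (trans (solve 2 (λ p u → p :* u := (p :* con 1ℚ) :* (con 1ℚ :* u)) refl p (walk p k diagonal 0 1))
          (trans (walk-diagonal p k 0 1) (cong (_* z ^ ⌊ k ℕ.+ 1 /2⌋) (returns-sym k 0 1))))
        (trans (solve 2 (λ q u → q :* u := con 1ℚ :* ((q :* con 1ℚ) :* u)) refl (1ℚ - p) (walk p k diagonal 1 0))
          (walk-diagonal p k 1 0)))
      (ℚ.+-inverseʳ (returns k 1 0 * z ^ ⌊ k ℕ.+ 1 /2⌋))

  -- Chebyshev's bound for the winning probability of a biased coin.

  -- A positive score forces a ≤ b, hence b - a + l ≥ l ≥ 0; a zero score leaves only a square on
  -- the right.
  score-square : ∀ {l} → 0ℚ ≤ l → ∀ a b →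
    l * l * score a b ≤ (fromℕ b - fromℕ a + l) * (fromℕ b - fromℕ a + l)
  score-square {l} 0≤l zero zero = ≤-by-diff (½ * (l * l)) (0≤* 0≤½ (0≤square l))
    (solve 1 (λ l → l :* l :* con ½ :+ con ½ :* (l :* l)
      := (con 0ℚ :- con 0ℚ :+ l) :* (con 0ℚ :- con 0ℚ :+ l)) refl l)
  score-square {l} 0≤l zero (suc b) = ≤-by-diff (x * x + (x * l + x * l))
    (0≤+ (0≤square x) (0≤+ (0≤* 0≤x 0≤l) (0≤* 0≤x 0≤l)))
    (solve 2 (λ l x → l :* l :* con 1ℚ :+ (x :* x :+ (x :* l :+ x :* l))
      := (x :- con 0ℚ :+ l) :* (x :- con 0ℚ :+ l)) refl l x)
    where
    x : ℚ
    x = fromℕ (suc b)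
    0≤x : 0ℚ ≤ x
    0≤x = 0≤fromℕ (suc b)
  score-square {l} 0≤l (suc a) zero =
    subst (_≤ x * x) (sym (ℚ.*-zeroʳ (l * l))) (0≤square x)
    where
    x : ℚ
    x = 0ℚ - fromℕ (suc a) + l
  score-square {l} 0≤l (suc a) (suc b) = subst (λ y → l * l * score a b ≤ (y + l) * (y + l))
    (solve 2 (λ b a → b :- a := (con 1ℚ :+ b) :- (con 1ℚ :+ a)) refl (fromℕ b) (fromℕ a))
    (score-square 0≤l a b)

  -- Chebyshev's argument: score a b ≤ ((b - a + l) / l)², and the right-hand
  -- side below is the second moment of b - a + l after k steps.
  walk-chebyshev : ∀ {p l} → 0ℚ ≤ p → p ≤ 1ℚ → 0ℚ ≤ l → ∀ k a b →
    let y = fromℕ b - fromℕ a + fromℕ k * (p + p - 1ℚ) + l in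
    l * l * walk p k score a b ≤ y * y + fromℕ k * ((p + p) * ((1ℚ - p) + (1ℚ - p)))
  walk-chebyshev {p} {l} 0≤p p≤1 0≤l zero a b = ℚ.≤-trans (score-square 0≤l a b)
    (ℚ.≤-reflexive (solve 3 (λ y p l → (y :+ l) :* (y :+ l)
        := (y :+ con 0ℚ :* (p :+ p :- con 1ℚ) :+ l) :* (y :+ con 0ℚ :* (p :+ p :- con 1ℚ) :+ l)
          :+ con 0ℚ :* ((p :+ p) :* ((con 1ℚ :- p) :+ (con 1ℚ :- p)))) refl (fromℕ b - fromℕ a) p l))
  walk-chebyshev {p} {l} 0≤p p≤1 0≤l (suc k) a b = subst₂ _≤_
    (solve 4 (λ p l u v → p :* (l :* l :* u) :+ (con 1ℚ :- p) :* (l :* l :* v)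
        := l :* l :* (p :* u :+ (con 1ℚ :- p) :* v)) refl
      p l (walk p k score a (suc b)) (walk p k score (suc a) b))
    (solve 5 (λ p l a b k →
        let y₁ = (con 1ℚ :+ b) :- a :+ k :* (p :+ p :- con 1ℚ) :+ l
            y₂ = b :- (con 1ℚ :+ a) :+ k :* (p :+ p :- con 1ℚ) :+ l
            y  = b :- a :+ (con 1ℚ :+ k) :* (p :+ p :- con 1ℚ) :+ l
            v  = (p :+ p) :* ((con 1ℚ :- p) :+ (con 1ℚ :- p))
        in p :* (y₁ :* y₁ :+ k :* v) :+ (con 1ℚ :- p) :* (y₂ :* y₂ :+ k :* v)
             := y :* y :+ (con 1ℚ :+ k) :* v) refl
      p l (fromℕ a) (fromℕ b) (fromℕ k))
    (ℚ.+-mono-≤ (*-monoˡ 0≤p (walk-chebyshev 0≤p p≤1 0≤l k a (suc b)))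
      (*-monoˡ (0≤diff p≤1) (walk-chebyshev 0≤p p≤1 0≤l k (suc a) b)))

  square-mono : ∀ {x y} → 0ℚ ≤ x → x ≤ y → x * x ≤ y * y
  square-mono 0≤x x≤y = ℚ.≤-trans (*-monoˡ 0≤x x≤y) (*-monoʳ (ℚ.≤-trans 0≤x x≤y) x≤y)

  -- With K = k the second moment is the variance 4 p (1 - p) K ≤ K, and l ≥ K c. Chebyshev's bound
  -- therefore gives at most 1 / (K c²), which the last hypothesis makes at most η.
  win-small : ∀ {p c η} → 0ℚ ≤ p → 0ℚ < c → p + c ≤ ½ → 0ℚ ≤ η →
    ∀ k → 1ℚ ≤ fromℕ k * (c * c * η) → win p k ≤ η
  win-small {p} {c} {η} 0≤p 0<c p+c≤½ 0≤η zero 1≤ =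
    ⊥-elim (ℚ.<-irrefl refl (ℚ.<-≤-trans (ℚ.positive⁻¹ 1ℚ)
      (ℚ.≤-trans 1≤ (ℚ.≤-reflexive (ℚ.*-zeroˡ (c * c * η))))))
  win-small {p} {c} {η} 0≤p 0<c p+c≤½ 0≤η k@(suc k-1) 1≤ =
    ℚ.*-cancelˡ-≤-pos (m * m) {{ℚ.positive (0<* 0<m 0<m)}} (begin
      m * m * win p k  ≤⟨ *-monoʳ (0≤walk-score 0≤p p≤1 k 0 0) (square-mono (ℚ.<⇒≤ 0<m) m≤l) ⟩
      l * l * win p k  ≤⟨ walk-chebyshev 0≤p p≤1 (ℚ.≤-trans (ℚ.<⇒≤ 0<m) m≤l) k 0 0 ⟩
      y * y + K * v    ≤⟨ ≤-by-diff (K * ((1ℚ - (p + p)) * (1ℚ - (p + p)))) (0≤* 0≤K (0≤square (1ℚ - (p + p))))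
                            (solve 2 (λ p K →
                              let y = con 0ℚ :- con 0ℚ :+ K :* (p :+ p :- con 1ℚ) :+ K :* (con 1ℚ :- (p :+ p))
                                  v = (p :+ p) :* ((con 1ℚ :- p) :+ (con 1ℚ :- p))
                              in y :* y :+ K :* v :+ K :* ((con 1ℚ :- (p :+ p)) :* (con 1ℚ :- (p :+ p)))
                                   := K :* con 1ℚ) refl p K) ⟩
      K * 1ℚ           ≤⟨ *-monoˡ 0≤K 1≤ ⟩
      K * (K * (c * c * η))
                       ≡⟨ solve 3 (λ K c η → K :* (K :* (c :* c :* η)) := K :* c :* (K :* c) :* η) refl K c η ⟩
      m * m * η        ∎)
    where
    open ℚ.≤-Reasoning
    K m l y v : ℚ
    K = fromℕ k
    m = K * c
    -- The negative of the mean of b - a after k steps, so that y below is zero.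
    l = K * (1ℚ - (p + p))
    y = 0ℚ - 0ℚ + K * (p + p - 1ℚ) + l
    v = (p + p) * ((1ℚ - p) + (1ℚ - p))
    0≤c : 0ℚ ≤ c
    0≤c = ℚ.<⇒≤ 0<c
    0<K : 0ℚ < K
    0<K = ℚ.+-mono-<-≤ (ℚ.positive⁻¹ 1ℚ) (0≤fromℕ k-1)
    0≤K : 0ℚ ≤ K
    0≤K = ℚ.<⇒≤ 0<K
    0<m : 0ℚ < m
    0<m = 0<* 0<K 0<c
    p≤1 : p ≤ 1ℚ
    p≤1 = ≤-by-diff (½ - (p + c) + (c + ½)) (0≤+ (0≤diff p+c≤½) (0≤+ 0≤c 0≤½))
      (solve 2 (λ p c → p :+ (con ½ :- (p :+ c) :+ (c :+ con ½)) := con 1ℚ) refl p c)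
    m≤l : m ≤ l
    m≤l = *-monoˡ 0≤K (≤-by-diff (½ - (p + c) + (½ - (p + c)) + c)
      (0≤+ (0≤+ (0≤diff p+c≤½) (0≤diff p+c≤½)) 0≤c)
      (solve 2 (λ p c → c :+ (con ½ :- (p :+ c) :+ (con ½ :- (p :+ c)) :+ c) := con 1ℚ :- (p :+ p)) refl p c))

  -- The mixture of two coins: maxima at the ends, and the limit.

  -- As long as `Up` has not been met there are only descents, so g stays at or below `g 0`. If `Up`
  -- holds at k it persists, and g climbs from k to d.
  max-at-ends : (g : ℕ → ℚ) (Up : ℕ → Set) →
    (∀ k → g (suc k) ≤ g k ⊎ Up k) →
    (∀ k → Up k → Up (suc k)) →
    (∀ k → Up k → g k ≤ g (suc k)) →
    ∀ {k d} → k ℕ.≤ d → g k ≤ g 0 ⊎ g k ≤ g d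
  max-at-ends g Up down-or-up up-suc up-≤ {k} {d} k≤d with below-start k
    where
    below-start : ∀ k → g k ≤ g 0 ⊎ Up k
    below-start zero = inj₁ ℚ.≤-refl
    below-start (suc k) with below-start k | down-or-up k
    ... | inj₂ up | _         = inj₂ (up-suc k up)
    ... | inj₁ _  | inj₂ up   = inj₂ (up-suc k up)
    ... | inj₁ le | inj₁ down = inj₁ (ℚ.≤-trans down le)
  ... | inj₁ le = inj₁ le
  ... | inj₂ up = inj₂ (climb (ℕ.≤⇒≤′ k≤d) .proj₁)
    where
    climb : ∀ {d} → k ℕ.≤′ d → g k ≤ g d × Up d
    climb (ℕ.≤′-reflexive refl) = ℚ.≤-refl , up
    climb (ℕ.≤′-step k≤d) with climb k≤d
    ... | le , up′ = ℚ.≤-trans le (up-≤ _ up′) , up-suc _ up′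

  mixWin : ℚ → ℚ → ℚ → ℕ → ℚ
  mixWin α p₁ p₂ k = (1ℚ - α) * win p₁ k + α * win p₂ k

  mixWin-0 : ∀ α p₁ p₂ → mixWin α p₁ p₂ 0 ≡ ½
  mixWin-0 α p₁ p₂ = solve 1 (λ α → (con 1ℚ :- α) :* con ½ :+ α :* con ½ := con ½) refl α

  -- The hypotheses as they hold for the approximating rationals at one index. The margin c is a
  -- parameter because the Chebyshev estimate must use the same c at every index.
  record Admissible (c α p₁ p₂ : ℚ) : Set where
    field
      0≤α      : 0ℚ ≤ α
      α≤1      : α ≤ 1ℚ
      0≤p₁     : 0ℚ ≤ p₁
      p₁+c≤½   : p₁ + c ≤ ½
      ½+c≤p₂   : ½ + c ≤ p₂
      p₂≤1     : p₂ ≤ 1ℚ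
      majority : ½ ≤ (1ℚ - α) * (1ℚ - p₁) + α * (1ℚ - p₂)

    p₁≤½ : 0ℚ < c → p₁ ≤ ½
    p₁≤½ 0<c = ℚ.≤-trans (≤-by-diff c (ℚ.<⇒≤ 0<c) refl) p₁+c≤½

    ½≤p₂ : 0ℚ < c → ½ ≤ p₂
    ½≤p₂ 0<c = ℚ.≤-trans (≤-by-diff c (ℚ.<⇒≤ 0<c) refl) ½+c≤p₂

  -- Passing from j to j + 1 multiplies the smaller side by x and the larger by y, and x ≤ y.
  scaled-power-suc : ∀ {a b x y} → 0ℚ ≤ x → 0ℚ ≤ b → x ≤ y → ∀ j → b * x ^ j ≤ a * y ^ j →
    b * x ^ suc j ≤ a * y ^ suc j
  scaled-power-suc {a} {b} {x} {y} 0≤x 0≤b x≤y j le = begin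
    b * (x * x ^ j)  ≡⟨ solve 3 (λ b x u → b :* (x :* u) := x :* (b :* u)) refl b x (x ^ j) ⟩
    x * (b * x ^ j)  ≤⟨ *-monoʳ (0≤* 0≤b (0≤^ 0≤x j)) x≤y ⟩
    y * (b * x ^ j)  ≤⟨ *-monoˡ (ℚ.≤-trans 0≤x x≤y) le ⟩
    y * (a * y ^ j)  ≡⟨ solve 3 (λ b x u → x :* (b :* u) := b :* (x :* u)) refl a y (y ^ j) ⟩
    a * (y * y ^ j)  ∎
    where open ℚ.≤-Reasoning

  half-suc : ∀ k → ⌊ suc k /2⌋ ≡ ⌊ k /2⌋ ⊎ ⌊ suc k /2⌋ ≡ suc ⌊ k /2⌋
  half-suc zero          = inj₁ refl
  half-suc (suc zero)    = inj₂ refl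
  half-suc (suc (suc k)) = Sum.map (cong suc) (cong suc) (half-suc k)

  mixWin-max-at-ends : ∀ {c α p₁ p₂} → 0ℚ < c → Admissible c α p₁ p₂ → ∀ {k d} → k ℕ.≤ d →
    mixWin α p₁ p₂ k ≤ mixWin α p₁ p₂ 0 ⊎ mixWin α p₁ p₂ k ≤ mixWin α p₁ p₂ d
  mixWin-max-at-ends {c} {α} {p₁} {p₂} 0<c adm = max-at-ends g Up down-or-up up-suc up-≤
    where
    open Admissible adm
    g : ℕ → ℚ
    g = mixWin α p₁ p₂
    a b r s : ℚ
    a = α * (p₂ - ½)
    b = (1ℚ - α) * (½ - p₁)
    r = p₂ * (1ℚ - p₂)
    s = p₁ * (1ℚ - p₁)

    0≤r : 0ℚ ≤ r
    0≤r = 0≤* (ℚ.≤-trans 0≤½ (½≤p₂ 0<c)) (0≤diff p₂≤1)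
    0≤s : 0ℚ ≤ s
    0≤s = 0≤* 0≤p₁ (0≤diff {y = 1ℚ} (ℚ.≤-trans (p₁≤½ 0<c) (ℚ.≤ᵇ⇒≤ _)))
    0≤a : 0ℚ ≤ a
    0≤a = 0≤* 0≤α (0≤diff (½≤p₂ 0<c))
    0≤b : 0ℚ ≤ b
    0≤b = 0≤* (0≤diff α≤1) (0≤diff (p₁≤½ 0<c))
    -- The difference b - a is exactly the majority weight minus ½.
    a≤b : a ≤ b
    a≤b = ≤-by-diff ((1ℚ - α) * (1ℚ - p₁) + α * (1ℚ - p₂) - ½) (0≤diff majority)
      (solve 3 (λ α p₁ p₂ → α :* (p₂ :- con ½)
          :+ ((con 1ℚ :- α) :* (con 1ℚ :- p₁) :+ α :* (con 1ℚ :- p₂) :- con ½)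
          := (con 1ℚ :- α) :* (con ½ :- p₁)) refl α p₁ p₂)

    g-step : ∀ k → g (suc k) ≡ g k + returns k 0 0 * (a * r ^ ⌊ k /2⌋ - b * s ^ ⌊ k /2⌋)
    g-step k = trans (cong₂ (λ u v → (1ℚ - α) * u + α * v) (win-step p₁ k) (win-step p₂ k))
      (solve 9 (λ α p₁ p₂ h u v c x y →
          (con 1ℚ :- α) :* (u :+ (p₁ :- h) :* (c :* x)) :+ α :* (v :+ (p₂ :- h) :* (c :* y))
          := (con 1ℚ :- α) :* u :+ α :* v
            :+ c :* (α :* (p₂ :- h) :* y :- (con 1ℚ :- α) :* (h :- p₁) :* x)) refl
        α p₁ p₂ ½ (win p₁ k) (win p₂ k) (returns k 0 0) (s ^ ⌊ k /2⌋) (r ^ ⌊ k /2⌋))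

    -- The first component is what carries the second from one exponent to the next.
    Up : ℕ → Set
    Up k = s ≤ r × b * s ^ ⌊ k /2⌋ ≤ a * r ^ ⌊ k /2⌋

    up-≤ : ∀ k → Up k → g k ≤ g (suc k)
    up-≤ k (_ , le) = ≤-by-diff _ (0≤* (0≤returns k 0 0) (0≤diff le)) (sym (g-step k))

    down-≤ : ∀ k → a * r ^ ⌊ k /2⌋ ≤ b * s ^ ⌊ k /2⌋ → g (suc k) ≤ g k
    down-≤ k le = ≤-by-diff (returns k 0 0 * (b * s ^ ⌊ k /2⌋ - a * r ^ ⌊ k /2⌋))
      (0≤* (0≤returns k 0 0) (0≤diff le))
      (trans (cong (_+ returns k 0 0 * (b * s ^ ⌊ k /2⌋ - a * r ^ ⌊ k /2⌋)) (g-step k))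
        (solve 4 (λ g c x y → g :+ c :* (x :- y) :+ c :* (y :- x) := g) refl
          (g k) (returns k 0 0) (a * r ^ ⌊ k /2⌋) (b * s ^ ⌊ k /2⌋)))

    up-suc : ∀ k → Up k → Up (suc k)
    up-suc k (s≤r , le) with half-suc k
    ... | inj₁ eq = s≤r , subst (λ j → b * s ^ j ≤ a * r ^ j) (sym eq) le
    ... | inj₂ eq = s≤r , subst (λ j → b * s ^ j ≤ a * r ^ j) (sym eq)
      (scaled-power-suc {a} {b} 0≤s 0≤b s≤r ⌊ k /2⌋ le)

    down-or-up : ∀ k → g (suc k) ≤ g k ⊎ Up k
    down-or-up k with ℚ.≤-total r s
    -- Here a ≤ b starts an induction on the exponent, so every increment is a descent.
    ... | inj₁ r≤s = inj₁ (down-≤ k (all-down ⌊ k /2⌋))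
      where
      all-down : ∀ j → a * r ^ j ≤ b * s ^ j
      all-down zero    = *-monoʳ 0≤1 a≤b
      all-down (suc j) = scaled-power-suc {b} {a} 0≤r 0≤a r≤s j (all-down j)
    ... | inj₂ s≤r with ℚ.≤-total (a * r ^ ⌊ k /2⌋) (b * s ^ ⌊ k /2⌋)
    ...   | inj₁ le = inj₁ (down-≤ k le)
    ...   | inj₂ le = inj₂ (s≤r , le)

  -- 1 - win p₂ k is the winning probability for the coin 1 - p₂, so both
  -- error terms are controlled by win-small.
  mixWin-near : ∀ {c α p₁ p₂ η} → 0ℚ < c → Admissible c α p₁ p₂ → 0ℚ ≤ η →
    ∀ k → 1ℚ ≤ fromℕ k * (c * c * η) →
    mixWin α p₁ p₂ k ≤ α + η × α ≤ mixWin α p₁ p₂ k + η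
  mixWin-near {c} {α} {p₁} {p₂} {η} 0<c adm 0≤η k large =
      ≤-by-diff ((1ℚ - α) * (η - u) + α * (η + v))
        (0≤+ (0≤* (0≤diff α≤1) (0≤diff u≤η)) (0≤* 0≤α (0≤+ 0≤η 0≤v)))
        (trans (cong (λ w → (1ℚ - α) * u + α * w + ((1ℚ - α) * (η - u) + α * (η + v))) (sym eq))
          (solve 4 (λ α u v η → (con 1ℚ :- α) :* u :+ α :* (con 1ℚ :- v)
              :+ ((con 1ℚ :- α) :* (η :- u) :+ α :* (η :+ v)) := α :+ η) refl α u v η))
    , ≤-by-diff ((1ℚ - α) * (u + η) + α * (η - v))
        (0≤+ (0≤* (0≤diff α≤1) (0≤+ 0≤u 0≤η)) (0≤* 0≤α (0≤diff v≤η)))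
        (trans (solve 4 (λ α u v η → α :+ ((con 1ℚ :- α) :* (u :+ η) :+ α :* (η :- v))
              := (con 1ℚ :- α) :* u :+ α :* (con 1ℚ :- v) :+ η) refl α u v η)
          (cong (λ w → (1ℚ - α) * u + α * w + η) eq))
    where
    open Admissible adm
    u v : ℚ
    u = win p₁ k
    v = win (1ℚ - p₂) k
    eq : 1ℚ - v ≡ win p₂ k
    eq = walk-complement p₂ k 0 0
    0≤c : 0ℚ ≤ c
    0≤c = ℚ.<⇒≤ 0<c
    q+c≤½ : 1ℚ - p₂ + c ≤ ½
    q+c≤½ = ≤-by-diff (p₂ - (½ + c)) (0≤diff ½+c≤p₂)
      (solve 2 (λ p c → con 1ℚ :- p :+ c :+ (p :- (con ½ :+ c)) := con ½) refl p₂ c)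
    ≤1 : ∀ {p} → p + c ≤ ½ → p ≤ 1ℚ
    ≤1 {p} le = ℚ.≤-trans (≤-by-diff c 0≤c refl) (ℚ.≤-trans le (ℚ.≤ᵇ⇒≤ _))
    u≤η : u ≤ η
    u≤η = win-small 0≤p₁ 0<c p₁+c≤½ 0≤η k large
    v≤η : v ≤ η
    v≤η = win-small (0≤diff p₂≤1) 0<c q+c≤½ 0≤η k large
    0≤u : 0ℚ ≤ u
    0≤u = 0≤walk-score 0≤p₁ (≤1 p₁+c≤½) k 0 0
    0≤v : 0ℚ ≤ v
    0≤v = 0≤walk-score (0≤diff p₂≤1) (≤1 q+c≤½) k 0 0

  -- Any natural number above 1 / δ serves as the threshold.
  multiples-unbounded : ∀ {δ} → 0ℚ < δ → ∃[ N ] (∀ n → N ℕ.≤ n → 1ℚ ≤ fromℕ n * δ)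
  multiples-unbounded {δ} 0<δ with archimedean (ℚ.1/_ δ {{ℚ.pos⇒nonZero δ {{ℚ.positive 0<δ}}}})
  ... | N , 1/δ≤N = N , λ n N≤n → subst (_≤ fromℕ n * δ)
    (ℚ.*-inverseˡ δ {{ℚ.pos⇒nonZero δ {{ℚ.positive 0<δ}}}})
    (*-monoʳ (ℚ.<⇒≤ 0<δ) (ℚ.≤-trans 1/δ≤N (fromℕ-mono N≤n)))

-- Expectations over the cube, and the probabilities of the game as walks.

module CubeExpectation where

  open RationalWalk
  open import Defs hiding (_+_; _*_; _-_; -_; _≤_; _<_; _^_; ∣_∣; ½)
  open import Data.Rational.Base using (_+_; _*_; _-_; ½)
  open +-*-Solver using (solve; _:=_; _:+_; _:*_; _:-_; con)

  -- Only the Boolean `does` is inspected, so that comparisons of two successors reduce to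
  -- comparisons of their predecessors.
  indicator : ∀ {A : Set} → Dec A → ℚ
  indicator A? with does A?
  ... | true  = 1ℚ
  ... | false = 0ℚ

  sum : List ℚ → ℚ
  sum = foldr _+_ 0ℚ

  sum-++ : ∀ xs ys → sum (xs ++ ys) ≡ sum xs + sum ys
  sum-++ []       ys = sym (ℚ.+-identityˡ (sum ys))
  sum-++ (x ∷ xs) ys = trans (cong (x +_) (sum-++ xs ys)) (sym (ℚ.+-assoc x (sum xs) (sum ys)))

  sum-linear : ∀ {A : Set} a b {f g h : A → ℚ} → (∀ x → h x ≡ a * f x + b * g x) → ∀ xs →
    sum (List.map h xs) ≡ a * sum (List.map f xs) + b * sum (List.map g xs)
  sum-linear a b eq [] = solve 2 (λ a b → con 0ℚ := a :* con 0ℚ :+ b :* con 0ℚ) refl a b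
  sum-linear a b {f} {g} eq (x ∷ xs) = trans (cong₂ _+_ (eq x) (sum-linear a b eq xs))
    (solve 6 (λ a b f g s t → a :* f :+ b :* g :+ (a :* s :+ b :* t) := a :* (f :+ s) :+ b :* (g :+ t)) refl
      a b (f x) (g x) (sum (List.map f xs)) (sum (List.map g xs)))

  sum-scale : ∀ {A : Set} a {f h : A → ℚ} → (∀ x → h x ≡ a * f x) → ∀ xs →
    sum (List.map h xs) ≡ a * sum (List.map f xs)
  sum-scale a eq []       = sym (ℚ.*-zeroʳ a)
  sum-scale a {f} eq (x ∷ xs) = trans (cong₂ _+_ (eq x) (sum-scale a eq xs))
    (sym (ℚ.*-distribˡ-+ a (f x) (sum (List.map f xs))))

  sum-points : ∀ {d} (f : Q (suc d) → ℚ) →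
    sum (List.map f (points (suc d)))
      ≡ sum (List.map (f ∘ (false ∷_)) (points d)) + sum (List.map (f ∘ (true ∷_)) (points d))
  sum-points {d} f = trans
    (cong sum (map-++ f (List.map (false ∷_) (points d)) (List.map (true ∷_) (points d))))
    (trans (sum-++ (List.map f (List.map (false ∷_) (points d))) (List.map f (List.map (true ∷_) (points d))))
      (cong₂ (λ u v → sum u + sum v) (sym (map-∘ (points d))) (sym (map-∘ (points d)))))

  mass : ℚ → ∀ {d} → Q d → ℚ
  mass p {d} Z = p ^ weight Z * (1ℚ - p) ^ (d ℕ.∸ weight Z)

  mass-true : ∀ p {d} (Z : Q d) → mass p (true ∷ Z) ≡ p * mass p Z
  mass-true p Z = ℚ.*-assoc p (p ^ weight Z) _

  mass-false : ∀ p {d} (Z : Q d) → mass p (false ∷ Z) ≡ (1ℚ - p) * mass p Z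
  mass-false p {d} Z = trans
    -- The weight is at most d, so the truncated difference grows by exactly one when d does.
    (cong (λ m → p ^ weight Z * (1ℚ - p) ^ m) (ℕ.+-∸-assoc 1 (count≤n (_≟ᵇ true) Z)))
    (solve 3 (λ u q v → u :* (q :* v) := q :* (u :* v)) refl
      (p ^ weight Z) (1ℚ - p) ((1ℚ - p) ^ (d ℕ.∸ weight Z)))

  -- Expectation under d independent p-coins, taken one coordinate at a time to match the recursion
  -- of `walk`; `sum-mass` identifies it with the weighted sum over the cube.
  expect : ℚ → ∀ {d} → (Q d → ℚ) → ℚ
  expect p {zero}  f = f []
  expect p {suc d} f = p * expect p (f ∘ (true ∷_)) + (1ℚ - p) * expect p (f ∘ (false ∷_))

  sum-mass : ∀ p {d} (f : Q d → ℚ) → sum (List.map (λ Z → mass p Z * f Z) (points d)) ≡ expect p f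
  sum-mass p {zero}  f = solve 1 (λ u → con 1ℚ :* con 1ℚ :* u :+ con 0ℚ := u) refl (f [])
  sum-mass p {suc d} f = trans (sum-points (λ Z → mass p Z * f Z))
    (trans (cong₂ _+_
        (trans (sum-scale (1ℚ - p)
            (λ Z → trans (cong (_* f (false ∷ Z)) (mass-false p Z)) (ℚ.*-assoc (1ℚ - p) (mass p Z) (f (false ∷ Z))))
            (points d))
          (cong ((1ℚ - p) *_) (sum-mass p (f ∘ (false ∷_)))))
        (trans (sum-scale p
            (λ Z → trans (cong (_* f (true ∷ Z)) (mass-true p Z)) (ℚ.*-assoc p (mass p Z) (f (true ∷ Z))))
            (points d))
          (cong (p *_) (sum-mass p (f ∘ (true ∷_))))))
      (ℚ.+-comm ((1ℚ - p) * expect p (f ∘ (false ∷_))) (p * expect p (f ∘ (true ∷_)))))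

  expect-cong : ∀ p {d} {f g : Q d → ℚ} → (∀ Z → f Z ≡ g Z) → expect p f ≡ expect p g
  expect-cong p {zero}  eq = eq []
  expect-cong p {suc d} eq = cong₂ (λ u v → p * u + (1ℚ - p) * v)
    (expect-cong p (eq ∘ (true ∷_))) (expect-cong p (eq ∘ (false ∷_)))

  expect-+* : ∀ p c {d} (f g : Q d → ℚ) → expect p (λ Z → f Z + c * g Z) ≡ expect p f + c * expect p g
  expect-+* p c {zero}  f g = refl
  expect-+* p c {suc d} f g = trans
    (cong₂ (λ u v → p * u + (1ℚ - p) * v)
      (expect-+* p c (f ∘ (true ∷_)) (g ∘ (true ∷_))) (expect-+* p c (f ∘ (false ∷_)) (g ∘ (false ∷_))))
    (solve 6 (λ p c s t u v → p :* (s :+ c :* t) :+ (con 1ℚ :- p) :* (u :+ c :* v)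
        := p :* s :+ (con 1ℚ :- p) :* u :+ c :* (p :* t :+ (con 1ℚ :- p) :* v)) refl
      p c (expect p (f ∘ (true ∷_))) (expect p (g ∘ (true ∷_)))
      (expect p (f ∘ (false ∷_))) (expect p (g ∘ (false ∷_))))

  average-same : ∀ p x → p * x + (1ℚ - p) * x ≡ x
  average-same = solve 2 (λ p x → p :* x :+ (con 1ℚ :- p) :* x := x) refl

  expect-const : ∀ p d c → expect p {d} (λ _ → c) ≡ c
  expect-const p zero    c = refl
  expect-const p (suc d) c = trans
    (cong₂ (λ u v → p * u + (1ℚ - p) * v) (expect-const p d c) (expect-const p d c)) (average-same p c)

  expect-coordinate : ∀ p {d} (i : Fin d) → expect p (λ Z → indicator (lookup Z i ≟ᵇ false)) ≡ 1ℚ - p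
  expect-coordinate p {suc d} zero = trans
    (cong₂ (λ u v → p * u + (1ℚ - p) * v) (expect-const p d 0ℚ) (expect-const p d 1ℚ))
    (solve 1 (λ p → p :* con 0ℚ :+ (con 1ℚ :- p) :* con 1ℚ := con 1ℚ :- p) refl p)
  expect-coordinate p (suc i) = trans
    (cong₂ (λ u v → p * u + (1ℚ - p) * v) (expect-coordinate p i) (expect-coordinate p i))
    (average-same p (1ℚ - p))

  indicator-score : ∀ a b → indicator (a ℕ.<? b) + ½ * indicator (a ℕ.≟ b) ≡ score a b
  indicator-score zero    zero    = refl
  indicator-score zero    (suc b) = refl
  indicator-score (suc a) zero    = refl
  indicator-score (suc a) (suc b) = indicator-score a b

  -- Outside the support of X both distances change by the same amount.
  expect-score : ∀ p {d} (X : Q d) a b →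
    expect p (λ Z → score (dist Z X ℕ.+ a) (dist Z 𝟎 ℕ.+ b)) ≡ walk p (weight X) score a b
  expect-score p []          a b = refl
  expect-score p (false ∷ X) a b = trans
    (average-same p (expect p (λ Z → score (dist Z X ℕ.+ a) (dist Z 𝟎 ℕ.+ b)))) (expect-score p X a b)
  expect-score p (true ∷ X)  a b = cong₂ (λ u v → p * u + (1ℚ - p) * v)
    (trans (expect-cong p (λ Z → cong (score (dist Z X ℕ.+ a)) (sym (ℕ.+-suc (dist Z 𝟎) b))))
      (expect-score p X a (suc b)))
    (trans (expect-cong p (λ Z → cong (λ m → score m (dist Z 𝟎 ℕ.+ b)) (sym (ℕ.+-suc (dist Z X) a))))
      (expect-score p X (suc a) b))

  expect-P₁ : ∀ p {d} (X : Q d) →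
    expect p (λ Z → indicator (V? X 𝟎 Z)) + ½ * expect p (λ Z → indicator (T? X 𝟎 Z)) ≡ win p (weight X)
  expect-P₁ p X = trans (sym (expect-+* p ½ (λ Z → indicator (V? X 𝟎 Z)) (λ Z → indicator (T? X 𝟎 Z))))
    (trans (expect-cong p (λ Z → trans (indicator-score (dist Z X) (dist Z 𝟎))
        (cong₂ score (sym (ℕ.+-identityʳ (dist Z X))) (sym (ℕ.+-identityʳ (dist Z 𝟎))))))
      (expect-score p X 0 0))

  seq-^ : ∀ x k n → seq (x Defs.^ k) n ≡ seq x n ^ k
  seq-^ x zero    n = refl
  seq-^ x (suc k) n = cong (seq x n *_) (seq-^ x k n)

  seq-mixture : ∀ α p₁ p₂ {d} (X : Q d) n → seq (mixture α p₁ p₂ d X) n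
    ≡ (1ℚ - seq α n) * mass (seq p₁ n) X + seq α n * mass (seq p₂ n) X
  seq-mixture α p₁ p₂ {d} X n = cong₂ (λ u v → (1ℚ - seq α n) * u + seq α n * v) (product p₁) (product p₂)
    where
    product : ∀ p → seq (p Defs.^ weight X Defs.* (1ℝ Defs.- p) Defs.^ (d ℕ.∸ weight X)) n ≡ mass (seq p n) X
    product p = cong₂ _*_ (seq-^ p (weight X) n) (seq-^ (1ℝ Defs.- p) (d ℕ.∸ weight X) n)

  seq-∑ : ∀ {A : Set} (f : A → ℝ) xs n → seq (∑ (List.map f xs)) n ≡ sum (List.map (λ x → seq (f x) n) xs)
  seq-∑ f []       n = refl
  seq-∑ f (x ∷ xs) n = cong (seq (f x) n +_) (seq-∑ f xs n)

  sum-filter : ∀ {A : Set} {S : Pred A 0ℓ} (S? : Decidable S) (f : A → ℚ) xs →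
    sum (List.map f (filter S? xs)) ≡ sum (List.map (λ x → f x * indicator (S? x)) xs)
  sum-filter S? f []       = refl
  sum-filter S? f (x ∷ xs) with does (S? x)
  ... | true  = cong₂ _+_ (sym (ℚ.*-identityʳ (f x))) (sum-filter S? f xs)
  ... | false = trans (sum-filter S? f xs) (trans (sym (ℚ.+-identityˡ _))
    (cong (_+ sum (List.map (λ x → f x * indicator (S? x)) xs)) (sym (ℚ.*-zeroʳ (f x)))))

  mixture-sum : ∀ α p₁ p₂ {d} (f : Q d → ℚ) n →
    sum (List.map (λ Z → seq (mixture α p₁ p₂ d Z) n * f Z) (points d))
      ≡ (1ℚ - seq α n) * expect (seq p₁ n) f + seq α n * expect (seq p₂ n) f
  mixture-sum α p₁ p₂ {d} f n = trans
    (sum-linear (1ℚ - seq α n) (seq α n)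
      (λ Z → trans (cong (_* f Z) (seq-mixture α p₁ p₂ Z n))
        (solve 5 (λ a b u v f → (a :* u :+ b :* v) :* f := a :* (u :* f) :+ b :* (v :* f)) refl
          (1ℚ - seq α n) (seq α n) (mass (seq p₁ n) Z) (mass (seq p₂ n) Z) (f Z)))
      (points d))
    (cong₂ (λ u v → (1ℚ - seq α n) * u + seq α n * v) (sum-mass (seq p₁ n) f) (sum-mass (seq p₂ n) f))

  -- The total mass is the expectation of the constant 1, which is 1 for either coin.
  seq-total : ∀ α p₁ p₂ d n → seq (∑ (List.map (mixture α p₁ p₂ d) (points d))) n ≡ 1ℚ
  seq-total α p₁ p₂ d n = trans (seq-∑ μ (points d) n)
    (trans (trans (sym (ℚ.*-identityˡ _)) (sym (sum-scale 1ℚ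
        (λ Z → trans (ℚ.*-identityʳ (seq (μ Z) n)) (sym (ℚ.*-identityˡ (seq (μ Z) n)))) (points d))))
      (trans (mixture-sum α p₁ p₂ {d} (λ _ → 1ℚ) n)
        (trans (cong₂ (λ u v → (1ℚ - seq α n) * u + seq α n * v)
            (expect-const (seq p₁ n) d 1ℚ) (expect-const (seq p₂ n) d 1ℚ))
          (solve 1 (λ α → (con 1ℚ :- α) :* con 1ℚ :+ α :* con 1ℚ := con 1ℚ) refl (seq α n)))))
    where
    μ : Q d → ℝ
    μ = mixture α p₁ p₂ d

  seq-measure : ∀ α p₁ p₂ {d} {S : Pred (Q d) 0ℓ} (S? : Decidable S) n →
    seq (measure (mixture α p₁ p₂ d) S?) n
      ≡ (1ℚ - seq α n) * expect (seq p₁ n) (λ Z → indicator (S? Z))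
          + seq α n * expect (seq p₂ n) (λ Z → indicator (S? Z))
  seq-measure α p₁ p₂ {d} S? n = trans (seq-∑ μ (filter S? (points d)) n)
    (trans (sum-filter S? (λ Z → seq (μ Z) n) (points d)) (mixture-sum α p₁ p₂ (λ Z → indicator (S? Z)) n))
    where
    μ : Q d → ℝ
    μ = mixture α p₁ p₂ d

  seq-w⁰ : ∀ α p₁ p₂ {d} (i : Fin d) n → seq (w⁰ (mixture α p₁ p₂ d) i) n
    ≡ (1ℚ - seq α n) * (1ℚ - seq p₁ n) + seq α n * (1ℚ - seq p₂ n)
  seq-w⁰ α p₁ p₂ i n = trans (seq-measure α p₁ p₂ (λ Z → lookup Z i ≟ᵇ false) n)
    (cong₂ (λ u v → (1ℚ - seq α n) * u + seq α n * v)
      (expect-coordinate (seq p₁ n) i) (expect-coordinate (seq p₂ n) i))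

  seq-P₁ : ∀ α p₁ p₂ {d} (X : Q d) n →
    seq (P₁ (mixture α p₁ p₂ d) X 𝟎) n ≡ mixWin (seq α n) (seq p₁ n) (seq p₂ n) (weight X)
  seq-P₁ α p₁ p₂ X n = trans
    (cong₂ (λ u v → u + ½ * v) (seq-measure α p₁ p₂ (V? X 𝟎) n) (seq-measure α p₁ p₂ (T? X 𝟎) n))
    (trans
      (solve 7 (λ a b h s t u v → a :* s :+ b :* t :+ h :* (a :* u :+ b :* v)
          := a :* (s :+ h :* u) :+ b :* (t :+ h :* v)) refl
        (1ℚ - seq α n) (seq α n) ½
        (expect (seq p₁ n) (λ Z → indicator (V? X 𝟎 Z))) (expect (seq p₂ n) (λ Z → indicator (V? X 𝟎 Z)))
        (expect (seq p₁ n) (λ Z → indicator (T? X 𝟎 Z))) (expect (seq p₂ n) (λ Z → indicator (T? X 𝟎 Z))))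
      (cong₂ (λ u v → (1ℚ - seq α n) * u + seq α n * v) (expect-P₁ (seq p₁ n) X) (expect-P₁ (seq p₂ n) X)))

  -- P₂ 𝟎 X and P₁ X 𝟎 differ only in how the tie set is written.
  seq-P₂ : ∀ α p₁ p₂ {d} (X : Q d) n →
    seq (P₂ (mixture α p₁ p₂ d) 𝟎 X) n ≡ seq (P₁ (mixture α p₁ p₂ d) X 𝟎) n
  seq-P₂ α p₁ p₂ {d} X n = cong (λ u → seq (measure (mixture α p₁ p₂ d) (V? X 𝟎)) n + ½ * u)
    (trans (seq-measure α p₁ p₂ (T? 𝟎 X) n)
      (trans (cong₂ (λ u v → (1ℚ - seq α n) * u + seq α n * v) (ties (seq p₁ n)) (ties (seq p₂ n)))
        (sym (seq-measure α p₁ p₂ (T? X 𝟎) n))))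
    where
    indicator-≟-sym : ∀ a b → indicator (a ℕ.≟ b) ≡ indicator (b ℕ.≟ a)
    indicator-≟-sym zero    zero    = refl
    indicator-≟-sym zero    (suc b) = refl
    indicator-≟-sym (suc a) zero    = refl
    indicator-≟-sym (suc a) (suc b) = indicator-≟-sym a b
    ties : ∀ p → expect p (λ Z → indicator (T? 𝟎 X Z)) ≡ expect p (λ Z → indicator (T? X 𝟎 Z))
    ties p = expect-cong p (λ Z → indicator-≟-sym (dist Z 𝟎) (dist Z X))

  weight-𝟎 : ∀ d → weight (𝟎 {d}) ≡ 0
  weight-𝟎 zero    = refl
  weight-𝟎 (suc d) = weight-𝟎 d

  weight-𝟏 : ∀ d → weight (𝟏 {d}) ≡ d
  weight-𝟏 zero    = refl
  weight-𝟏 (suc d) = cong suc (weight-𝟏 d)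

-- Comparison of Cauchy reals through their terms.

open import Defs
open RationalWalk using (≤-by-diff; 0≤diff; 0≤*; 0≤+; 0<*; 0≤^; mixWin; mixWin-0; mixWin-max-at-ends; mixWin-near; multiples-unbounded; Admissible)
open CubeExpectation

≡⇒≈ : ∀ {x y} → (∀ n → seq x n ≡ seq y n) → x ≈ y
≡⇒≈ {x} {y} eq = mk≈ λ ε 0<ε → 0 , λ n _ →
  subst (λ z → ℚ.∣ z ∣ ℚ.< ε) (sym (trans (cong (ℚ._- seq y n) (eq n)) (ℚ.+-inverseʳ (seq y n)))) 0<ε

eventually⇒≤ : ∀ {x y} N → (∀ n → N ℕ.≤ n → seq x n ℚ.≤ seq y n) → x ≤ y
eventually⇒≤ N le = mk≤ λ ε 0<ε → N , λ n n≥ →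
  ℚ.≤-trans (le n n≥) (≤-by-diff ε (ℚ.<⇒≤ 0<ε) refl)

≤-resp-≡ : ∀ {x x′ y y′} → (∀ n → seq x n ≡ seq x′ n) → (∀ n → seq y n ≡ seq y′ n) → x ≤ y → x′ ≤ y′
≤-resp-≡ x≡ y≡ (mk≤ within) = mk≤ λ ε 0<ε → let N , le = within ε 0<ε in
  N , λ n n≥ → subst₂ (λ u v → u ℚ.≤ v ℚ.+ ε) (x≡ n) (y≡ n) (le n n≥)

<-resp-≡ : ∀ {x x′ y y′} → (∀ n → seq x n ≡ seq x′ n) → (∀ n → seq y n ≡ seq y′ n) → x < y → x′ < y′
<-resp-≡ x≡ y≡ (mk< c 0<c N le) = mk< c 0<c N λ n n≥ →
  subst₂ (λ u v → u ℚ.+ c ℚ.≤ v) (x≡ n) (y≡ n) (le n n≥)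

-- Which alternative holds may change with the index; z ≤ y turns the second into the first up to ε.
≤-dominated : ∀ {x y z} N → (∀ n → N ℕ.≤ n → seq x n ℚ.≤ seq y n ⊎ seq x n ℚ.≤ seq z n) → z ≤ y → x ≤ y
≤-dominated N le (mk≤ within) = mk≤ λ ε 0<ε → let M , z≤y = within ε 0<ε in
  N ℕ.⊔ M , λ n n≥ → Sum.[ (λ x≤y → ℚ.≤-trans x≤y (≤-by-diff ε (ℚ.<⇒≤ 0<ε) refl))
                         , (λ x≤z → ℚ.≤-trans x≤z (z≤y n (ℕ.m⊔n≤o⇒n≤o N M n≥))) ]
                         (le n (ℕ.m⊔n≤o⇒m≤o N M n≥))

<⇒≤ : ∀ {x y} → x < y → x ≤ y
<⇒≤ (mk< c 0<c N le) = eventually⇒≤ N λ n n≥ → ℚ.≤-trans (≤-by-diff c (ℚ.<⇒≤ 0<c) refl) (le n n≥)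

0<half : ∀ {ε} → 0ℚ ℚ.< ε → 0ℚ ℚ.< ℚ.½ ℚ.* ε
0<half = 0<* (ℚ.positive⁻¹ ℚ.½)

<⇒≱ : ∀ {x y} → x < y → ¬ y ≤ x
-- Half the gap is taken as the tolerance: at a common index x + c ≤ y ≤ x + c/2 is absurd.
<⇒≱ {x} {y} (mk< c 0<c N x+c≤y) (mk≤ within) with within (ℚ.½ ℚ.* c) (0<half 0<c)
... | M , y≤x+c/2 = ℚ.<-irrefl refl (ℚ.<-≤-trans (0<half 0<c) (begin
    ℚ.½ ℚ.* c                          ≡⟨ solve 2 (λ x c → con ℚ.½ :* c := x :+ c :- (x :+ con ℚ.½ :* c)) refl (seq x n) c ⟩
    seq x n ℚ.+ c ℚ.- (seq x n ℚ.+ ℚ.½ ℚ.* c)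
      ≤⟨ ℚ.+-monoˡ-≤ (ℚ.- (seq x n ℚ.+ ℚ.½ ℚ.* c)) (ℚ.≤-trans (x+c≤y n (ℕ.m≤m⊔n N M)) (y≤x+c/2 n (ℕ.m≤n⊔m N M))) ⟩
    seq x n ℚ.+ ℚ.½ ℚ.* c ℚ.- (seq x n ℚ.+ ℚ.½ ℚ.* c)
      ≡⟨ ℚ.+-inverseʳ (seq x n ℚ.+ ℚ.½ ℚ.* c) ⟩
    0ℚ                                 ∎))
  where
  open ℚ.≤-Reasoning
  open +-*-Solver
  n : ℕ
  n = N ℕ.⊔ M

p≤∣p∣ : ∀ p → p ℚ.≤ ℚ.∣ p ∣
p≤∣p∣ p with ℚ.∣p∣≡p∨∣p∣≡-p p | ℚ.≤-total 0ℚ p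
... | inj₁ eq | _        = ℚ.≤-reflexive (sym eq)
... | inj₂ _  | inj₁ 0≤p = ℚ.≤-reflexive (sym (ℚ.0≤p⇒∣p∣≡p 0≤p))
... | inj₂ _  | inj₂ p≤0 = ℚ.≤-trans p≤0 (ℚ.0≤∣p∣ p)

∣p-q∣<e⇒p≤q+e : ∀ p q {e} → ℚ.∣ p ℚ.- q ∣ ℚ.< e → p ℚ.≤ q ℚ.+ e
∣p-q∣<e⇒p≤q+e p q {e} close = ≤-by-diff (e ℚ.- (p ℚ.- q))
  (0≤diff (ℚ.≤-trans (p≤∣p∣ (p ℚ.- q)) (ℚ.<⇒≤ close)))
  (solve 3 (λ p q e → p :+ (e :- (p :- q)) := q :+ e) refl p q e)
  where open +-*-Solver

-- One rational comparison, with threshold 3δ, is made at an index M past which both sequences move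
-- by less than δ. Above the threshold a gap of δ survives the two fluctuations; below it y exceeds
-- x by at most 5δ from M on.
<-or-near : ∀ x y δ → 0ℚ ℚ.< δ →
  x < y ⊎ ∃[ N ] (∀ n → N ℕ.≤ n → seq y n ℚ.≤ seq x n ℚ.+ δ ℚ.+ (δ ℚ.+ δ ℚ.+ δ) ℚ.+ δ)
<-or-near x y δ 0<δ with cauchy x δ 0<δ | cauchy y δ 0<δ
... | M₁ , x-close | M₂ , y-close = compare (ℚ.≤-total (seq y M) (seq x M ℚ.+ (δ ℚ.+ δ ℚ.+ δ)))
  where
  open ℚ.≤-Reasoning
  open +-*-Solver
  M : ℕ
  M = M₁ ℕ.⊔ M₂

  M₁≤ : ∀ {n} → M ℕ.≤ n → M₁ ℕ.≤ n
  M₁≤ = ℕ.m⊔n≤o⇒m≤o M₁ M₂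

  M₂≤ : ∀ {n} → M ℕ.≤ n → M₂ ℕ.≤ n
  M₂≤ = ℕ.m⊔n≤o⇒n≤o M₁ M₂

  compare : seq y M ℚ.≤ seq x M ℚ.+ (δ ℚ.+ δ ℚ.+ δ) ⊎ seq x M ℚ.+ (δ ℚ.+ δ ℚ.+ δ) ℚ.≤ seq y M →
    x < y ⊎ ∃[ N ] (∀ n → N ℕ.≤ n → seq y n ℚ.≤ seq x n ℚ.+ δ ℚ.+ (δ ℚ.+ δ ℚ.+ δ) ℚ.+ δ)
  compare (inj₁ y≤x+3δ) = inj₂ (M , λ n n≥ → begin
    seq y n                                 ≤⟨ ∣p-q∣<e⇒p≤q+e (seq y n) (seq y M) (y-close n M (M₂≤ n≥) (M₂≤ ℕ.≤-refl)) ⟩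
    seq y M ℚ.+ δ                           ≤⟨ ℚ.+-monoˡ-≤ δ y≤x+3δ ⟩
    seq x M ℚ.+ (δ ℚ.+ δ ℚ.+ δ) ℚ.+ δ       ≤⟨ ℚ.+-monoˡ-≤ δ (ℚ.+-monoˡ-≤ (δ ℚ.+ δ ℚ.+ δ)
                                                 (∣p-q∣<e⇒p≤q+e (seq x M) (seq x n) (x-close M n (M₁≤ ℕ.≤-refl) (M₁≤ n≥)))) ⟩
    seq x n ℚ.+ δ ℚ.+ (δ ℚ.+ δ ℚ.+ δ) ℚ.+ δ ∎)
  compare (inj₂ x+3δ≤y) = inj₁ (mk< δ 0<δ M λ n n≥ → begin
    seq x n ℚ.+ δ                           ≤⟨ ℚ.+-monoˡ-≤ δ (∣p-q∣<e⇒p≤q+e (seq x n) (seq x M) (x-close n M (M₁≤ n≥) (M₁≤ ℕ.≤-refl))) ⟩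
    seq x M ℚ.+ δ ℚ.+ δ                     ≡⟨ solve 2 (λ x δ → x :+ δ :+ δ := x :+ (δ :+ δ :+ δ) :- δ) refl (seq x M) δ ⟩
    seq x M ℚ.+ (δ ℚ.+ δ ℚ.+ δ) ℚ.- δ       ≤⟨ ℚ.+-monoˡ-≤ (ℚ.- δ) x+3δ≤y ⟩
    seq y M ℚ.- δ                           ≤⟨ ℚ.+-monoˡ-≤ (ℚ.- δ) (∣p-q∣<e⇒p≤q+e (seq y M) (seq y n) (y-close M n (M₂≤ ℕ.≤-refl) (M₂≤ n≥))) ⟩
    seq y n ℚ.+ δ ℚ.- δ                     ≡⟨ solve 2 (λ y δ → y :+ δ :- δ := y) refl (seq y n) δ ⟩
    seq y n                                 ∎)

-- If x < y fails, `<-or-near` must give its second alternative for every δ; with δ = ε/5 the total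
-- error is ε.
<-or-≥ : ExcludedMiddle 0ℓ → ∀ x y → x < y ⊎ y ≤ x
<-or-≥ em x y with em {x < y}
... | yes x<y = inj₁ x<y
... | no  x≮y = inj₂ (mk≤ λ ε 0<ε → Sum.[ (λ x<y → ⊥-elim (x≮y x<y)) , (λ (N , near) → N , λ n n≥ →
    ℚ.≤-trans (near n n≥) (ℚ.≤-reflexive
      (solve 2 (λ x ε → let δ = con ⅕ :* ε in x :+ δ :+ (δ :+ δ :+ δ) :+ δ := x :+ ε) refl (seq x n) ε))) ]
    (<-or-near x y (⅕ ℚ.* ε) (0<* (ℚ.positive⁻¹ ⅕) 0<ε)))
  where
  open +-*-Solver
  ⅕ : ℚ
  ⅕ = ℤ.+ 1 ℚ./ 5

∣∣-lub : ∀ {p e} → p ℚ.≤ e → ℚ.- p ℚ.≤ e → ℚ.∣ p ∣ ℚ.≤ e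
∣∣-lub {p} {e} p≤e -p≤e with ℚ.∣p∣≡p∨∣p∣≡-p p
... | inj₁ eq = subst (ℚ._≤ e) (sym eq) p≤e
... | inj₂ eq = subst (ℚ._≤ e) (sym eq) -p≤e

mapᵉ : ∀ {P R : ℕ → Set} → (∀ n → P n → R n) → Eventually P → Eventually R
mapᵉ f (N , p) = N , λ n n≥ → f n (p n n≥)

_∧ᵉ_ : ∀ {P R : ℕ → Set} → Eventually P → Eventually R → Eventually (λ n → P n × R n)
(M , p) ∧ᵉ (N , r) = M ℕ.⊔ N , λ n n≥ → p n (ℕ.m⊔n≤o⇒m≤o M N n≥) , r n (ℕ.m⊔n≤o⇒n≤o M N n≥)

infixr 4 _∧ᵉ_

seq-below : ∀ {x y} → x < y → Eventually (λ n → seq x n ℚ.≤ seq y n)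
seq-below (mk< c 0<c N le) = N , λ n n≥ → ℚ.≤-trans (≤-by-diff c (ℚ.<⇒≤ 0<c) refl) (le n n≥)

seq-below-by : ∀ {x y c} (x<y : x < y) → c ℚ.≤ _<_.gap x<y → Eventually (λ n → seq x n ℚ.+ c ℚ.≤ seq y n)
seq-below-by {x} (mk< _ _ N le) c≤gap = N , λ n n≥ → ℚ.≤-trans (ℚ.+-monoʳ-≤ (seq x n) c≤gap) (le n n≥)

-- Each strict inequality of reals holds termwise from some index on. The smaller of the gaps
-- separating p₁ and p₂ from ½ is the common margin.
admissible : ∀ {α p₁ p₂} → 0ℝ < α → α < 1ℝ → 0ℝ < p₁ → p₁ < ½ → ½ < p₂ → p₂ < 1ℝ →
  ½ < (1ℝ - α) * (1ℝ - p₁) + α * (1ℝ - p₂) →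
  ∃[ c ] (0ℚ ℚ.< c × Eventually (λ n → Admissible c (seq α n) (seq p₁ n) (seq p₂ n)))
admissible 0<α α<1 0<p₁ p₁<½ ½<p₂ p₂<1 majority = c , 0<c , mapᵉ (λ n (0≤α , α≤1 , 0≤p₁ , p₁+c≤½ , ½+c≤p₂ , p₂≤1 , maj) → record
    { 0≤α = 0≤α ; α≤1 = α≤1 ; 0≤p₁ = 0≤p₁ ; p₁+c≤½ = p₁+c≤½ ; ½+c≤p₂ = ½+c≤p₂ ; p₂≤1 = p₂≤1 ; majority = maj })
  (seq-below 0<α ∧ᵉ seq-below α<1 ∧ᵉ seq-below 0<p₁ ∧ᵉ seq-below-by p₁<½ (ℚ.p⊓q≤p c₁ c₂)
    ∧ᵉ seq-below-by ½<p₂ (ℚ.p⊓q≤q c₁ c₂) ∧ᵉ seq-below p₂<1 ∧ᵉ seq-below majority)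
  where
  c₁ c₂ c : ℚ
  c₁ = _<_.gap p₁<½
  c₂ = _<_.gap ½<p₂
  c  = c₁ ℚ.⊓ c₂
  0<c : 0ℚ ℚ.< c
  0<c with ℚ.⊓-sel c₁ c₂
  ... | inj₁ eq = subst (0ℚ ℚ.<_) (sym eq) (_<_.gap-pos p₁<½)
  ... | inj₂ eq = subst (0ℚ ℚ.<_) (sym eq) (_<_.gap-pos ½<p₂)

-- The game under the mixture, over the reals.

module MixtureGame (em : ExcludedMiddle 0ℓ) (α p₁ p₂ : ℝ) (c : ℚ) (0<c : 0ℚ ℚ.< c) (N : ℕ)
  (adm : ∀ n → N ℕ.≤ n → Admissible c (seq α n) (seq p₁ n) (seq p₂ n)) where

  open +-*-Solver using (solve; _:=_; _:+_; _:*_; _:-_; :-_; con)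

  μ : ∀ d → Q d → ℝ
  μ = mixture α p₁ p₂

  mixWin-seq : ℕ → ℕ → ℚ
  mixWin-seq n = mixWin (seq α n) (seq p₁ n) (seq p₂ n)

  seq-P₁-𝟎 : ∀ d n → seq (P₁ (μ d) 𝟎 𝟎) n ≡ mixWin-seq n 0
  seq-P₁-𝟎 d n = trans (seq-P₁ α p₁ p₂ (𝟎 {d}) n) (cong (mixWin-seq n) (weight-𝟎 d))

  seq-P₁-𝟏 : ∀ d n → seq (P₁ (μ d) 𝟏 𝟎) n ≡ mixWin-seq n d
  seq-P₁-𝟏 d n = trans (seq-P₁ α p₁ p₂ (𝟏 {d}) n) (cong (mixWin-seq n) (weight-𝟏 d))

  seq-P₁-𝟎≡½ : ∀ d n → seq (P₁ (μ d) 𝟎 𝟎) n ≡ ℚ.½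
  seq-P₁-𝟎≡½ d n = trans (seq-P₁-𝟎 d n) (mixWin-0 (seq α n) (seq p₁ n) (seq p₂ n))

  P₁-max-at-ends : ∀ {d} (X : Q d) n → N ℕ.≤ n →
    seq (P₁ (μ d) X 𝟎) n ℚ.≤ seq (P₁ (μ d) 𝟎 𝟎) n ⊎ seq (P₁ (μ d) X 𝟎) n ℚ.≤ seq (P₁ (μ d) 𝟏 𝟎) n
  P₁-max-at-ends {d} X n n≥ = Sum.map
    (subst₂ ℚ._≤_ (sym (seq-P₁ α p₁ p₂ X n)) (sym (seq-P₁-𝟎 d n)))
    (subst₂ ℚ._≤_ (sym (seq-P₁ α p₁ p₂ X n)) (sym (seq-P₁-𝟏 d n)))
    (mixWin-max-at-ends 0<c (adm n n≥) (count≤n (_≟ᵇ true) X))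

  bestResponse-𝟎 : ∀ d → P₁ (μ d) 𝟏 𝟎 ≤ P₁ (μ d) 𝟎 𝟎 → IsBestResponse (μ d) 𝟎 𝟎
  bestResponse-𝟎 d le X = ≤-dominated N (P₁-max-at-ends X) le

  bestResponse-𝟏 : ∀ d → P₁ (μ d) 𝟎 𝟎 ≤ P₁ (μ d) 𝟏 𝟎 → IsBestResponse (μ d) 𝟏 𝟎
  bestResponse-𝟏 d le X = ≤-dominated N (λ n n≥ → Sum.swap (P₁-max-at-ends X n n≥)) le

  -- The game is symmetric: `P₂` at (𝟎 , X) has the same terms as `P₁` at (X , 𝟎), so one
  -- best-response inequality serves both players.
  equilibrium-𝟎 : ∀ d → IsBestResponse (μ d) 𝟎 𝟎 → IsEquilibrium (μ d) 𝟎 𝟎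
  equilibrium-𝟎 d best = best , λ X → ≤-resp-≡
    (λ n → sym (seq-P₂ α p₁ p₂ X n)) (λ n → sym (seq-P₂ α p₁ p₂ (𝟎 {d}) n)) (best X)

  -- The better end may differ from index to index, so the two real values at the ends are compared,
  -- by excluded middle, to choose one end for all X.
  bestResponse-at-ends : ∀ d →
    (IsBestResponse (μ d) 𝟎 𝟎 × IsEquilibrium (μ d) 𝟎 𝟎) ⊎ IsBestResponse (μ d) 𝟏 𝟎
  bestResponse-at-ends d = Sum.swap (Sum.map
    (λ lt → bestResponse-𝟏 d (<⇒≤ lt))
    (λ le → bestResponse-𝟎 d le , equilibrium-𝟎 d (bestResponse-𝟎 d le))
    (<-or-≥ em (P₁ (μ d) 𝟎 𝟎) (P₁ (μ d) 𝟏 𝟎)))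

  mixture-isDistribution : ∀ d → IsDistribution (μ d)
  mixture-isDistribution d = (λ X → eventually⇒≤ N (λ n n≥ → subst (0ℚ ℚ.≤_)
      (sym (seq-mixture α p₁ p₂ X n)) (0≤mass X n (adm n n≥))))
    , ≡⇒≈ (seq-total α p₁ p₂ d)
    where
    0≤mass : ∀ X n → Admissible c (seq α n) (seq p₁ n) (seq p₂ n) →
      0ℚ ℚ.≤ (1ℚ ℚ.- seq α n) ℚ.* mass (seq p₁ n) X ℚ.+ seq α n ℚ.* mass (seq p₂ n) X
    0≤mass X n a = 0≤+
      (0≤* (0≤diff α≤1) (0≤* (0≤^ 0≤p₁ (weight X)) (0≤^ (0≤diff p₁≤1) (d ℕ.∸ weight X))))
      (0≤* 0≤α (0≤* (0≤^ 0≤p₂ (weight X)) (0≤^ (0≤diff p₂≤1) (d ℕ.∸ weight X))))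
      where
      open Admissible a
      p₁≤1 : seq p₁ n ℚ.≤ 1ℚ
      p₁≤1 = ℚ.≤-trans (p₁≤½ 0<c) (ℚ.≤ᵇ⇒≤ _)
      0≤p₂ : 0ℚ ℚ.≤ seq p₂ n
      0≤p₂ = ℚ.≤-trans (ℚ.≤ᵇ⇒≤ _) (½≤p₂ 0<c)

  w⁰-value : ∀ d (i : Fin d) → w⁰ (μ d) i ≈ (1ℝ - α) * (1ℝ - p₁) + α * (1ℝ - p₂)
  w⁰-value d i = ≡⇒≈ (seq-w⁰ α p₁ p₂ i)

  ½<w⁰ : ½ < (1ℝ - α) * (1ℝ - p₁) + α * (1ℝ - p₂) → ∀ d (i : Fin d) → ½ < w⁰ (μ d) i
  ½<w⁰ majority d i = <-resp-≡ (λ _ → refl) (λ n → sym (seq-w⁰ α p₁ p₂ i n)) majority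

  majorityPoint-𝟎 : ½ < (1ℝ - α) * (1ℝ - p₁) + α * (1ℝ - p₂) → ∀ d → IsMajorityPoint (μ d) 𝟎
  majorityPoint-𝟎 majority d i =
    subst (λ b → ½ < measure (μ d) (λ Z → lookup Z i ≟ᵇ b)) (sym (lookup-replicate i false)) (½<w⁰ majority d i)

  -- The same index N serves all dimensions d.
  Near : ℚ → ℕ → Set
  Near η d = ∀ n → N ℕ.≤ n →
    mixWin-seq n d ℚ.≤ seq α n ℚ.+ η × seq α n ℚ.≤ mixWin-seq n d ℚ.+ η

  mixWin-limit : ∀ η → 0ℚ ℚ.< η → Eventually (Near η)
  mixWin-limit η 0<η = mapᵉ (λ d large n n≥ → mixWin-near 0<c (adm n n≥) (ℚ.<⇒≤ 0<η) d large)
    -- Chebyshev's estimate applies once d c² η ≥ 1.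
    (multiples-unbounded (0<* (0<* 0<c 0<c) 0<η))

  -- A rational e > 0 lies below the terms of ε from some index on. Half of it bounds the distance
  -- to α, and the other half is the gap in the strict inequality.
  P₁-𝟏-tendsTo-α : TendsTo (λ d → P₁ (μ d) 𝟏 𝟎) α
  P₁-𝟏-tendsTo-α ε (mk< e 0<e M e≤ε) = mapᵉ {Near η} (λ d near → mk< η (0<half 0<e) (N ℕ.⊔ M) λ n n≥ →
      let g≤ , α≤ = near n (ℕ.m⊔n≤o⇒m≤o N M n≥) in
      ℚ.≤-trans (ℚ.+-monoˡ-≤ η (subst (λ g → ℚ.∣ g ℚ.- seq α n ∣ ℚ.≤ η) (sym (seq-P₁-𝟏 d n)) (distance g≤ α≤)))
        (ℚ.≤-trans (ℚ.≤-reflexive (solve 1 (λ e → con ℚ.½ :* e :+ con ℚ.½ :* e := con 0ℚ :+ e) refl e))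
          (e≤ε n (ℕ.m⊔n≤o⇒n≤o N M n≥))))
    (mixWin-limit η (0<half 0<e))
    where
    η : ℚ
    η = ℚ.½ ℚ.* e
    distance : ∀ {g a} → g ℚ.≤ a ℚ.+ η → a ℚ.≤ g ℚ.+ η → ℚ.∣ g ℚ.- a ∣ ℚ.≤ η
    distance {g} {a} g≤ a≤ = ∣∣-lub
      (≤-by-diff (a ℚ.+ η ℚ.- g) (0≤diff g≤)
        (solve 3 (λ g a η → g :- a :+ (a :+ η :- g) := η) refl g a η))
      (≤-by-diff (g ℚ.+ η ℚ.- a) (0≤diff a≤)
        (solve 3 (λ g a η → :- (g :- a) :+ (g :+ η :- a) := η) refl g a η))

  -- Half of the gap e between ½ and α is spent on the approximation; the other half keeps the
  -- inequality strict.
  ½<α⇒½<P₁-𝟏 : ½ < α → Eventually (λ d → ½ < P₁ (μ d) 𝟏 𝟎)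
  ½<α⇒½<P₁-𝟏 (mk< e 0<e M ½+e≤α) = mapᵉ {Near η} (λ d near → mk< η (0<half 0<e) (N ℕ.⊔ M) λ n n≥ →
      subst (ℚ.½ ℚ.+ η ℚ.≤_) (sym (seq-P₁-𝟏 d n))
        (cancel (ℚ.≤-trans (½+e≤α n (ℕ.m⊔n≤o⇒n≤o N M n≥)) (proj₂ (near n (ℕ.m⊔n≤o⇒m≤o N M n≥))))))
    (mixWin-limit η (0<half 0<e))
    where
    η : ℚ
    η = ℚ.½ ℚ.* e
    cancel : ∀ {g} → ℚ.½ ℚ.+ e ℚ.≤ g ℚ.+ η → ℚ.½ ℚ.+ η ℚ.≤ g
    cancel {g} le = ≤-by-diff (g ℚ.+ η ℚ.- (ℚ.½ ℚ.+ e)) (0≤diff le)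
      (solve 2 (λ g e → con ℚ.½ :+ con ℚ.½ :* e :+ (g :+ con ℚ.½ :* e :- (con ℚ.½ :+ e)) := g) refl g e)

  not-equilibrium : ∀ d → P₁ (μ d) 𝟎 𝟎 < P₁ (μ d) 𝟏 𝟎 → ¬ IsEquilibrium (μ d) 𝟎 𝟎
  not-equilibrium d lt (best , _) = <⇒≱ lt (best 𝟏)

  -- At (𝟎 , 𝟎) every point is a tie, so the value there is ½ and moving to 𝟏 is a strict
  -- improvement.
  ½<α⇒best-𝟏 : ½ < α → Eventually (λ d →
    ½ < P₁ (μ d) 𝟏 𝟎 × ¬ IsEquilibrium (μ d) 𝟎 𝟎 × IsBestResponse (μ d) 𝟏 𝟎)
  ½<α⇒best-𝟏 ½<α = mapᵉ (λ d ½<P → let lt = <-resp-≡ (λ n → sym (seq-P₁-𝟎≡½ d n)) (λ _ → refl) ½<P in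
      ½<P , not-equilibrium d lt , bestResponse-𝟏 d (<⇒≤ lt))
    (½<α⇒½<P₁-𝟏 ½<α)

  -- A weak inequality is the goal, so the whole gap e can serve as the error: the value at 𝟏 is at
  -- most α + e ≤ ½.
  α<½⇒equilibrium : α < ½ → Eventually (λ d → IsEquilibrium (μ d) 𝟎 𝟎)
  α<½⇒equilibrium (mk< e 0<e M α+e≤½) = mapᵉ {Near e} (λ d near → equilibrium-𝟎 d (bestResponse-𝟎 d
      (eventually⇒≤ (N ℕ.⊔ M) λ n n≥ →
        subst₂ ℚ._≤_ (sym (seq-P₁-𝟏 d n)) (sym (seq-P₁-𝟎≡½ d n))
          (ℚ.≤-trans (proj₁ (near n (ℕ.m⊔n≤o⇒m≤o N M n≥))) (α+e≤½ n (ℕ.m⊔n≤o⇒n≤o N M n≥))))))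
    (mixWin-limit e 0<e)

mainTheorem12 : ExcludedMiddle 0ℓ →
    (α p₁ p₂ : ℝ) →
    0ℝ < α → α < 1ℝ →
    0ℝ < p₁ → p₁ < ½ → ½ < p₂ → p₂ < 1ℝ →
    ½ < (1ℝ - α) * (1ℝ - p₁) + α * (1ℝ - p₂) →
    let μ = mixture α p₁ p₂ in
    ((d : ℕ) → 1 ℕ.≤ d →
    IsDistribution (μ d)
    × (∀ i → w⁰ (μ d) i ≈ (1ℝ - α) * (1ℝ - p₁) + α * (1ℝ - p₂))
    × (∀ i → ½ < w⁰ (μ d) i)
    × IsMajorityPoint (μ d) 𝟎
    × ((IsBestResponse (μ d) 𝟎 𝟎 × IsEquilibrium (μ d) 𝟎 𝟎)
    ⊎ IsBestResponse (μ d) 𝟏 𝟎))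
    × TendsTo (λ d → P₁ (μ d) 𝟏 𝟎) α
    × (½ < α → Eventually (λ d →
    ½ < P₁ (μ d) 𝟏 𝟎
    × ¬ IsEquilibrium (μ d) 𝟎 𝟎
    × IsBestResponse (μ d) 𝟏 𝟎))
    × (α < ½ → Eventually (λ d → IsEquilibrium (μ d) 𝟎 𝟎))
mainTheorem12 em α p₁ p₂ 0<α α<1 0<p₁ p₁<½ ½<p₂ p₂<1 majority =
  let c , 0<c , N , adm = admissible 0<α α<1 0<p₁ p₁<½ ½<p₂ p₂<1 majority
      open MixtureGame em α p₁ p₂ c 0<c N adm
  in (λ d _ → mixture-isDistribution d , w⁰-value d , ½<w⁰ majority d , majorityPoint-𝟎 majority d
        , bestResponse-at-ends d)
   , P₁-𝟏-tendsTo-α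
   , ½<α⇒best-𝟏
   , α<½⇒equilibrium
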